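{- Let $(P,\omega)$ be a labeled poset, let $\mathrm I$ denote the identity matrix indexed by $\mathcal I(P)$, and set $\widetilde A(P,\omega)=\mathrm I+A(P,\omega)$. Then $$E(P,\omega;\lambda)=\bigl(\mathrm I-\lambda\widetilde A(P,\omega)\bigr)^{ -1}$$ and $$E(P,\omega;\lambda)=\frac1{1-\lambda}\Bigl(\mathrm I-\frac{\lambda}{1-\lambda}A(P,\omega)\Bigr)^{ -1}.$$
   Context: All posets are finite and $\mathbb N^+=\{1,2,\dots\}$. An ideal of a poset $P$ is a down-closed subset; $\mathcal I(P)$ is the set of all ideals, including $\emptyset$ and $P$. A labeled poset $(P,\omega)$ is a finite poset $P$ with an injective map $\omega:P\to\mathbb N^+$. A subset $S\subseteq P$ is $\omega$-natural if $\omega|_S$ is order-preserving ($\emptyset$ is $\omega$-natural). The matrix $A(P,\omega)$ has rows and columns indexed by $\mathcal I(P)$; its $(I,J)$ entry is $1$ if $I\subsetneq J$ and $J\setminus I$ is $\omega$-natural, and $0$ otherwise (it is nilpotent). Define $$\Phi(P,\omega)=\ln(1+A(P,\omega))=\sum_{n\ge1}\frac{(-1)^{n-1}}{n}A(P,\omega)^n,\qquad \Theta(P,\omega;t)=e^{t\Phi(P,\omega)}=\sum_{n\ge0}\frac{\Phi(P,\omega)^n}{n!}t^n,$$ and, as a matrix of formal power series in the variable $\lambda$, $$E(P,\omega;\lambda)=\sum_{n=0}^\infty\Theta(P,\omega;n)\lambda^n .$$ -}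

module Defs where

open import Algebra.Bundles.Raw using (RawRing)
import Algebra.Definitions as AlgebraDefinitions
import Algebra.Definitions.RawSemiring as RawSemiringDefinitions
open import Data.Bool.Base using (if_then_else_)
open import Data.Fin.Base using (Fin; zero; suc; toℕ)
import Data.Fin.Properties as Fin
open import Data.Fin.Subset using (Subset; inside; outside; _∈_; _⊂_; _─_; ∣_∣)
open import Data.Fin.Subset.Properties using (_∈?_; _⊂?_; ∣p∣≤n; p⊂q⇒∣p∣<∣q∣)
import Data.Integer.Base as ℤ
open import Data.Irrelevant using ([_])
open import Data.Nat.Base as ℕ using (ℕ; zero; suc; NonZero; _!; z≤n; s≤s)
import Data.Nat.Properties as ℕ
open import Data.Product.Base using (∃; _,_; proj₁; proj₂)
import Data.Rational.Base as ℚ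
open ℚ using (ℚ; 0ℚ; 1ℚ)
import Data.Rational.Properties as ℚ
open import Data.Refinement using (Refinement; Refinement-syntax; _,_; value)
open import Data.Sum.Base using (_⊎_; inj₁; inj₂)
open import Data.Sum.Function.Propositional using (_⊎-↔_)
open import Data.Vec.Base using ([]; _∷_)
open import Data.Vec.Functional using (Vector)
open import Function.Base using (_∘_)
open import Function.Bundles using (_↔_; Inverse; mk↔ₛ′)
open import Function.Construct.Composition using (_↔-∘_)
open import Function.Definitions using (Injective)
open import Level using (Level; 0ℓ; _⊔_)
open import Relation.Binary.Core using (Rel)
open import Relation.Binary.Structures using (IsDecPartialOrder)
open import Relation.Binary.PropositionalEquality
  using (_≡_; refl; sym; trans; cong; cong₂)
open import Relation.Nullary.Decidable using (Dec; yes; no; does; _×-dec_; _→-dec_)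
open import Relation.Nullary.Negation using (contradiction; contradiction-irr)
open import Relation.Unary using (Decidable)

private
  variable
    c ℓ : Level

------------------------------------------------------------------------
-- Rings

module RingDefinitions (R : RawRing c ℓ) where

  open RawRing R public
  open RawSemiringDefinitions rawSemiring public using (sum; _^_)
  open AlgebraDefinitions _≈_ using (Invertible)

  infixl 6 _-_
  _-_ : Carrier → Carrier → Carrier
  x - y = x + (- y)

  -- The first component of IsUnit x is the inverse of x.
  IsUnit : Carrier → Set (c ⊔ ℓ)
  IsUnit = Invertible 1# _*_

  EventuallyZero : (ℕ → Carrier) → Set ℓ
  EventuallyZero f = ∃ λ N → ∀ n → N ℕ.≤ n → f n ≈ 0#

  -- An infinite sum is only formed when all but finitely many summands
  -- vanish.  The value does not depend on which bound is supplied.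
  ∑∞ : (f : ℕ → Carrier) → EventuallyZero f → Carrier
  ∑∞ f (N , _) = sum {N} (f ∘ toℕ)

-- R[[λ]]: a series is its sequence of coefficients.
module PowerSeries (R : RawRing c ℓ) where

  open RingDefinitions R

  constant : Carrier → ℕ → Carrier
  constant a zero    = a
  constant a (suc _) = 0#

  -- The variable of the power series ring ("λ" itself is reserved).
  ƛ : ℕ → Carrier
  ƛ 1 = 1#
  ƛ _ = 0#

  powerSeriesRing : RawRing c ℓ
  powerSeriesRing = record
    { Carrier = ℕ → Carrier
    ; _≈_     = λ f g → ∀ n → f n ≈ g n
    ; _+_     = λ f g n → f n + g n
    ; _*_     = λ f g n → sum {suc n} (λ i → f (toℕ i) * g (n ℕ.∸ toℕ i))
    ; -_      = λ f n → - f n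
    ; 0#      = λ _ → 0#
    ; 1#      = constant 1#
    }

-- Square matrices over R with rows and columns indexed by a finite set X.
module Matrices (R : RawRing c ℓ) {X : Set} {N : ℕ} (enum : Fin N ↔ X) where

  open RingDefinitions R
  open Inverse enum using (to; from)

  Matrix : Set c
  Matrix = X → X → Carrier

  identity : Matrix
  identity x y = if does (from x Fin.≟ from y) then 1# else 0#

  matrixRing : RawRing c ℓ
  matrixRing = record
    { Carrier = Matrix
    ; _≈_     = λ M M′ → ∀ x y → M x y ≈ M′ x y
    ; _+_     = λ M M′ x y → M x y + M′ x y
    ; _*_     = λ M M′ x y → sum {N} (λ k → M x (to k) * M′ (to k) y)
    ; -_      = λ M x y → - M x y
    ; 0#      = λ _ _ → 0#
    ; 1#      = identity
    }

  infixr 8 _•_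
  _•_ : Carrier → Matrix → Matrix
  (a • M) x y = a * M x y

------------------------------------------------------------------------
-- Labeled posets and their ideals

record LabeledPoset : Set₁ where
  infix 4 _≼_
  field
    size              : ℕ
    _≼_               : Rel (Fin size) 0ℓ
    isDecPartialOrder : IsDecPartialOrder _≡_ _≼_
    ω                 : Fin size → ℕ
    ω-positive        : ∀ x → NonZero (ω x)
    ω-injective       : Injective _≡_ _≡_ ω

  open IsDecPartialOrder isDecPartialOrder public
    using () renaming (_≤?_ to _≼?_)

  DownClosed : Subset size → Set
  DownClosed S = ∀ x y → y ≼ x → x ∈ S → y ∈ S

  Natural : Subset size → Set
  Natural S = ∀ x y → x ∈ S → y ∈ S → x ≼ y → ω x ℕ.≤ ω y

  downClosed? : Decidable DownClosed
  downClosed? S = Fin.all? λ x → Fin.all? λ y →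
    y ≼? x →-dec x ∈? S →-dec y ∈? S

  natural? : Decidable Natural
  natural? S = Fin.all? λ x → Fin.all? λ y →
    x ∈? S →-dec y ∈? S →-dec x ≼? y →-dec ω x ℕ.≤? ω y

  Ideal : Set
  Ideal = [ S ∈ Subset size ∣ DownClosed S ]

-- Every decidable family of subsets is finite.
module _ where

  private
    split : ∀ {n} {Q : Subset (suc n) → Set} →
            ([ S ∈ Subset n ∣ Q (inside ∷ S) ] ⊎ [ S ∈ Subset n ∣ Q (outside ∷ S) ])
              ↔ [ S ∈ Subset (suc n) ∣ Q S ]
    split = mk↔ₛ′
      (λ { (inj₁ (S , q)) → (inside ∷ S) , q ; (inj₂ (S , q)) → (outside ∷ S) , q })
      (λ { ((inside ∷ S) , q) → inj₁ (S , q) ; ((outside ∷ S) , q) → inj₂ (S , q) })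
      (λ { ((inside ∷ S) , q) → refl ; ((outside ∷ S) , q) → refl })
      (λ { (inj₁ _) → refl ; (inj₂ _) → refl })

    empty : ∀ {Q : Subset 0 → Set} → Dec (Q []) →
            ∃ λ N → Fin N ↔ [ S ∈ Subset 0 ∣ Q S ]
    empty (yes q) = 1 , mk↔ₛ′ (λ _ → [] , [ q ]) (λ _ → zero)
                              (λ { ([] , _) → refl }) (λ { zero → refl })
    empty (no ¬q) = 0 , mk↔ₛ′ (λ ()) (λ { ([] , [ q ]) → contradiction-irr q ¬q })
                              (λ { ([] , [ q ]) → contradiction-irr q ¬q }) (λ ())

  enumerate : ∀ {n} {Q : Subset n → Set} → Decidable Q →
              ∃ λ N → Fin N ↔ [ S ∈ Subset n ∣ Q S ]
  enumerate {zero}  Q? = empty (Q? [])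
  enumerate {suc n} Q? =
    let a , f = enumerate (λ S → Q? (inside ∷ S))
        b , g = enumerate (λ S → Q? (outside ∷ S))
    in a ℕ.+ b , (split ↔-∘ ((f ⊎-↔ g) ↔-∘ Fin.+↔⊎))

------------------------------------------------------------------------
-- The matrices attached to a labeled poset

module PosetMatrices (L : LabeledPoset) where

  open LabeledPoset L

  ideals : ∃ λ N → Fin N ↔ Ideal
  ideals = enumerate downClosed?

  module Mat = Matrices ℚ.+-*-rawRing (proj₂ ideals)
  open Mat using (Matrix; _•_)
  open RingDefinitions Mat.matrixRing
    using (_+_; _*_; 0#; 1#; sum; _^_; EventuallyZero; ∑∞)

  A : Matrix
  A I J = if does (value I ⊂? value J ×-dec natural? (value J ─ value I))
          then 1ℚ else 0ℚ

  Ã : Matrix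
  Ã = 1# + A

  -- The summand (-1)ⁿ⁻¹/n Aⁿ, shifted so that the index starts from 0.
  logTerm : ℕ → Matrix
  logTerm n = ((ℤ.-1ℤ ℤ.^ n) ℚ./ suc n) • A ^ suc n

  expCoefficient : ℚ → ℕ → ℚ
  expCoefficient t n = (ℤ.1ℤ ℚ./ (n !)) {{n ℕ.!≢0}} ℚ.* t ^ℚ n
    where open RingDefinitions ℚ.+-*-rawRing using () renaming (_^_ to _^ℚ_)

  expTerm : ℚ → Matrix → ℕ → Matrix
  expTerm t M n = expCoefficient t n • M ^ n

  -- Everything up to Degree-logTerm, and Degree-Φ below, only serves to show
  -- that the sums defining Φ and Θ are finite.  Degree k M says that M I J
  -- vanishes unless J has at least k more elements than I.
  card : Ideal → ℕ
  card I = ∣ value I ∣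

  Degree : ℕ → Matrix → Set
  Degree k M = ∀ I J → card J ℕ.< card I ℕ.+ k → M I J ≡ 0ℚ

  weaken : ∀ {k l M} → k ℕ.≤ l → Degree l M → Degree k M
  weaken k≤l d I J lt = d I J (ℕ.<-≤-trans lt (ℕ.+-monoʳ-≤ (card I) k≤l))

  Degree-1 : Degree 0 1#
  Degree-1 I J lt with Inverse.from (proj₂ ideals) I Fin.≟ Inverse.from (proj₂ ideals) J
  ... | no  _  = refl
  ... | yes eq = contradiction lt (ℕ.≤⇒≯ (ℕ.≤-reflexive (trans (ℕ.+-identityʳ _) (cong card
    (trans (sym (Inverse.strictlyInverseˡ (proj₂ ideals) I))
      (trans (cong (Inverse.to (proj₂ ideals)) eq)
        (Inverse.strictlyInverseˡ (proj₂ ideals) J)))))))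

  Degree-sum : ∀ {k n} (f : Vector Matrix n) → (∀ i → Degree k (f i)) → Degree k (sum f)
  Degree-sum {n = zero}  f d I J lt = refl
  Degree-sum {n = suc n} f d I J lt = cong₂ ℚ._+_
    (d zero I J lt) (Degree-sum (f ∘ suc) (d ∘ suc) I J lt)

  Degree-• : ∀ {k M} a → Degree k M → Degree k (a • M)
  Degree-• a d I J lt = trans (cong (a ℚ.*_) (d I J lt)) (ℚ.*-zeroʳ a)

  sum-zero : ∀ {n} (f : Vector ℚ n) → (∀ i → f i ≡ 0ℚ) →
             RingDefinitions.sum ℚ.+-*-rawRing f ≡ 0ℚ
  sum-zero {zero}  f z = refl
  sum-zero {suc n} f z = cong₂ ℚ._+_ (z zero) (sum-zero (f ∘ suc) (z ∘ suc))

  Degree-* : ∀ {k l M M′} → Degree k M → Degree l M′ → Degree (k ℕ.+ l) (M * M′)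
  Degree-* {k} {l} {M} {M′} d d′ I J lt = sum-zero _ λ i →
    product (Inverse.to (proj₂ ideals) i)
    where
    product : ∀ K → M I K ℚ.* M′ K J ≡ 0ℚ
    product K with card K ℕ.<? card I ℕ.+ k
    ... | yes K< = trans (cong (ℚ._* M′ K J) (d I K K<)) (ℚ.*-zeroˡ (M′ K J))
    ... | no  K≮ = trans (cong (M I K ℚ.*_) (d′ K J (ℕ.<-≤-trans lt
                     (ℕ.≤-trans (ℕ.≤-reflexive (sym (ℕ.+-assoc (card I) k l)))
                                (ℕ.+-monoˡ-≤ l (ℕ.≮⇒≥ K≮))))))
                     (ℚ.*-zeroʳ (M I K))

  Degree-^ : ∀ {M} → Degree 1 M → ∀ n → Degree n (M ^ n)
  Degree-^ d zero    = Degree-1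
  Degree-^ d (suc n) = Degree-* d (Degree-^ d n)

  Degree⇒0 : ∀ {k M} → size ℕ.< k → Degree k M → ∀ I J → M I J ≡ 0ℚ
  Degree⇒0 {k} lt d I J = d I J (ℕ.≤-<-trans (∣p∣≤n (value J))
    (ℕ.<-≤-trans lt (ℕ.m≤n+m k (card I))))

  Degree-A : Degree 1 A
  Degree-A I J lt with value I ⊂? value J
  ... | no  _   = refl
  ... | yes I⊂J = contradiction lt (ℕ.≤⇒≯
    (ℕ.≤-trans (ℕ.≤-reflexive (ℕ.+-comm (card I) 1)) (p⊂q⇒∣p∣<∣q∣ I⊂J)))

  Degree-logTerm : ∀ n → Degree (suc n) (logTerm n)
  Degree-logTerm n = Degree-• ((ℤ.-1ℤ ℤ.^ n) ℚ./ suc n) (Degree-^ Degree-A (suc n))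

  logTerm-eventuallyZero : EventuallyZero logTerm
  logTerm-eventuallyZero = size , λ n size≤n → Degree⇒0 (s≤s size≤n) (Degree-logTerm n)

  Φ : Matrix
  Φ = ∑∞ logTerm logTerm-eventuallyZero

  Degree-Φ : Degree 1 Φ
  Degree-Φ = Degree-sum {n = size} (logTerm ∘ toℕ) λ i →
    weaken (s≤s z≤n) (Degree-logTerm (toℕ i))

  expTerm-eventuallyZero : ∀ t → EventuallyZero (expTerm t Φ)
  expTerm-eventuallyZero t = suc size , λ n size<n →
    Degree⇒0 size<n (Degree-• (expCoefficient t n) (Degree-^ Degree-Φ n))

  Θ : ℚ → Matrix
  Θ t = ∑∞ (expTerm t Φ) (expTerm-eventuallyZero t)

module GeneratingFunction (L : LabeledPoset) where

  open PosetMatrices L public using (A; Ã)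
  open PosetMatrices L using (ideals; Θ; module Mat)
  open PowerSeries ℚ.+-*-rawRing public using (powerSeriesRing; constant; ƛ)
  module Mat[[λ]] = Matrices powerSeriesRing (proj₂ ideals)

  lift : Mat.Matrix → Mat[[λ]].Matrix
  lift M I J = constant (M I J)

  -- The coefficient of λⁿ in the (I,J) entry is the (I,J) entry of Θ(n).
  E : Mat[[λ]].Matrix
  E I J n = Θ (ℤ.+ n ℚ./ 1) I J

  -- Subscript ₛ marks operations on scalar power series.
  open Mat[[λ]] public using (_•_)
  open RingDefinitions Mat[[λ]].matrixRing public
    using (_≈_; _-_; IsUnit) renaming (1# to 𝐈)
  open RingDefinitions powerSeriesRing public
    using ()
    renaming (1# to 1ₛ; _*_ to _*ₛ_; _-_ to _-ₛ_; IsUnit to IsUnitₛ)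

{-# OPTIONS --safe #-}

-- Writing θ = x d/dx, the series f = exp(t ln(1 + x)) satisfies the equation
-- (1 + x) θf = t x f, which determines its coefficients recursively.  For
-- t = n the polynomial (1 + x)ⁿ solves the same equation, so the two agree,
-- and evaluating at the nilpotent matrix A gives Θ(n) = Ãⁿ.  Hence E is the
-- geometric series of λÃ.  The second formula follows from the factorisation
-- 1 - λÃ = (1 - λ)(1 - λ/(1 - λ) A).

module Submission where

open import Algebra.Bundles using (CommutativeMonoid; CommutativeRing; Ring)
open import Algebra.Bundles.Raw using (RawRing)
import Algebra.Construct.Pointwise as Pointwise
import Algebra.Properties.AbelianGroup as AbelianGroupProperties
import Algebra.Properties.CommutativeMonoid.Mult as CommutativeMonoidMult
import Algebra.Properties.CommutativeSemigroup as CommutativeSemigroupProperties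
import Algebra.Properties.Group as GroupProperties
import Algebra.Properties.Ring as RingProperties
import Algebra.Properties.Semiring.Exp as SemiringExp
import Algebra.Properties.Semiring.Mult as SemiringMult
import Algebra.Properties.Semiring.Sum as SemiringSum
open import Data.Bool.Base using (if_then_else_)
open import Data.Fin.Base using (Fin; zero; suc; toℕ; inject₁; fromℕ)
import Data.Fin.Properties as Fin
import Data.Integer.Base as ℤ
import Data.Integer.Properties as ℤ
open import Data.Nat.Base as ℕ using (ℕ; zero; suc; s≤s; z≤n; _!)
import Data.Nat.Properties as ℕ
open import Data.Product.Base using (_×_; _,_; proj₂; Σ-syntax)
import Data.Rational.Base as ℚ
open ℚ using (ℚ; 0ℚ; 1ℚ)
import Data.Rational.Properties as ℚ
import Data.Rational.Unnormalised.Base as ℚᵘ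
import Data.Rational.Unnormalised.Properties as ℚᵘ
open import Function.Base using (_∘_)
open import Function.Bundles using (_↔_; Inverse)
open import Level using (Level; _⊔_)
open import Relation.Binary.PropositionalEquality as ≡ using (_≡_)
import Relation.Binary.Reasoning.Setoid as SetoidReasoning
open import Relation.Nullary.Decidable using (yes; no; does)
open import Relation.Nullary.Negation using (contradiction)
open import Defs

-- The detour through series is forced: θ acts on series, whereas `A` is a fixed matrix with nothing
-- to differentiate. Coming back requires evaluation at `A` to be multiplicative, which fails for
-- truncated sums in general and holds because `A` is nilpotent. The exponential of a series is
-- never completed. It is cut off after as many summands as `Θ` has, and the cut-off solves the
-- differential equation only in low degrees, since differentiating it loses a summand. Because ln(1
-- + x) has no constant term, the lost summand has order `size`. So the coefficients agree with
-- those of (1 + x)ⁿ up to degree `size`, and evaluation at `A`, where `A ^ suc size` is zero, reads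
-- exactly those. Inverses are two-sided in a noncommutative ring, so the geometric series argument
-- is run twice, from E = 𝐈 + λEÃ and from E = 𝐈 + λÃE.

private
  variable
    c ℓ c′ ℓ′ : Level

-- Derivations

record IsDerivation (R : CommutativeRing c ℓ)
  (θ : CommutativeRing.Carrier R → CommutativeRing.Carrier R) : Set (c ⊔ ℓ) where
  open CommutativeRing R
  field
    θ-cong : ∀ {x y} → x ≈ y → θ x ≈ θ y
    θ-+    : ∀ x y → θ (x + y) ≈ θ x + θ y
    θ-*    : ∀ x y → θ (x * y) ≈ θ x * y + x * θ y

module Derivation (R : CommutativeRing c ℓ)
  {θ : CommutativeRing.Carrier R → CommutativeRing.Carrier R}
  (isDerivation : IsDerivation R θ)
  where

  open CommutativeRing R hiding (zero)
  open IsDerivation isDerivation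
  open SemiringSum semiring
  open SemiringExp semiring using (_^_)
  open SemiringMult semiring using (×-congʳ; ×-comm-*; ×-assoc-*) renaming (_×_ to _×ₙ_)
  open RingProperties ring using (x+x≈x⇒x≈0)
  open CommutativeSemigroupProperties *-commutativeSemigroup using (x∙yz≈y∙xz)
  open SetoidReasoning setoid

  θ-0 : θ 0# ≈ 0#
  θ-0 = x+x≈x⇒x≈0 _ (trans (sym (θ-+ 0# 0#)) (θ-cong (+-identityˡ 0#)))

  θ-1 : θ 1# ≈ 0#
  θ-1 = x+x≈x⇒x≈0 _ (begin
    θ 1# + θ 1#            ≈⟨ +-cong (*-identityʳ _) (*-identityˡ _) ⟨
    θ 1# * 1# + 1# * θ 1#  ≈⟨ θ-* 1# 1# ⟨
    θ (1# * 1#)            ≈⟨ θ-cong (*-identityˡ 1#) ⟩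
    θ 1#                   ∎)

  θ-^ : ∀ x n → θ (x ^ suc n) ≈ suc n ×ₙ (θ x * x ^ n)
  θ-^ x zero    = begin
    θ (x * 1#)           ≈⟨ θ-* x 1# ⟩
    θ x * 1# + x * θ 1#  ≈⟨ +-congˡ (trans (*-congˡ θ-1) (zeroʳ x)) ⟩
    θ x * 1# + 0#        ∎
  θ-^ x (suc n) = begin
    θ (x * x ^ suc n)
      ≈⟨ θ-* x (x ^ suc n) ⟩
    θ x * x ^ suc n + x * θ (x ^ suc n)
      ≈⟨ +-congˡ (*-congˡ (θ-^ x n)) ⟩
    θ x * x ^ suc n + x * (suc n ×ₙ (θ x * x ^ n))
      ≈⟨ +-congˡ (×-comm-* (suc n) x _) ⟩
    θ x * x ^ suc n + suc n ×ₙ (x * (θ x * x ^ n))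
      ≈⟨ +-congˡ (×-congʳ (suc n) (x∙yz≈y∙xz x (θ x) (x ^ n))) ⟩
    θ x * x ^ suc n + suc n ×ₙ (θ x * x ^ suc n) ∎

  -- Multiplying by `x` restores the power lost in differentiation, so the exponent is `n` again and
  -- `n = 0` is covered. With `x` = 1 + `ƛ` and `y` = `ƛ` this is the differential equation of the
  -- binomial polynomial.
  *-θ-^ : ∀ {x y} → θ x ≈ y → ∀ n → x * θ (x ^ n) ≈ n ×ₙ (y * x ^ n)
  *-θ-^         θx≈y zero    = trans (*-congˡ θ-1) (zeroʳ _)
  *-θ-^ {x} {y} θx≈y (suc n) = begin
    x * θ (x ^ suc n)             ≈⟨ *-congˡ (θ-^ x n) ⟩
    x * (suc n ×ₙ (θ x * x ^ n))  ≈⟨ ×-comm-* (suc n) x _ ⟩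
    suc n ×ₙ (x * (θ x * x ^ n))  ≈⟨ ×-congʳ (suc n) (x∙yz≈y∙xz x (θ x) (x ^ n)) ⟩
    suc n ×ₙ (θ x * x ^ suc n)    ≈⟨ ×-congʳ (suc n) (*-congʳ θx≈y) ⟩
    suc n ×ₙ (y * x ^ suc n)      ∎

  partialSum : (ℕ → Carrier) → Carrier → ℕ → Carrier
  partialSum e x n = sum {n} (λ k → e (toℕ k) * x ^ toℕ k)

  θ-sum : ∀ {n} (t : Fin n → Carrier) → θ (sum t) ≈ sum (θ ∘ t)
  θ-sum {zero}  t = θ-0
  θ-sum {suc n} t = trans (θ-+ _ _) (+-congˡ (θ-sum (t ∘ suc)))

  -- Chain rule for a truncated exponential. The recurrence on `e` is that of tᵏ/k!; it absorbs the
  -- factor k + 1 produced by `θ-^` and shifts the index, which costs one summand.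
  θ-exp : ∀ e t → (∀ k → θ (e k) ≈ 0#) → (∀ k → suc k ×ₙ e (suc k) ≈ t * e k) →
          ∀ x n → θ (partialSum e x (suc n)) ≈ t * (θ x * partialSum e x n)
  θ-exp e t θe≈0 e-suc x n = begin
    θ (e 0 * 1# + sum {n} (λ k → e (suc (toℕ k)) * x ^ suc (toℕ k)))
      ≈⟨ θ-+ _ _ ⟩
    θ (e 0 * 1#) + θ (sum {n} (λ k → e (suc (toℕ k)) * x ^ suc (toℕ k)))
      ≈⟨ +-cong (trans (θ-cong (*-identityʳ (e 0))) (θe≈0 0)) (θ-sum {n} _) ⟩
    0# + sum {n} (λ k → θ (e (suc (toℕ k)) * x ^ suc (toℕ k)))
      ≈⟨ +-identityˡ _ ⟩
    sum {n} (λ k → θ (e (suc (toℕ k)) * x ^ suc (toℕ k)))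
      ≈⟨ sum-cong-≋ {n} (λ k → step (toℕ k)) ⟩
    sum {n} (λ k → t * (θ x * (e (toℕ k) * x ^ toℕ k)))
      ≈⟨ *-distribˡ-sum {n} t _ ⟨
    t * sum {n} (λ k → θ x * (e (toℕ k) * x ^ toℕ k))
      ≈⟨ *-congˡ (*-distribˡ-sum {n} (θ x) _) ⟨
    t * (θ x * partialSum e x n) ∎
    where
    step : ∀ k → θ (e (suc k) * x ^ suc k) ≈ t * (θ x * (e k * x ^ k))
    step k = begin
      θ (e (suc k) * x ^ suc k)
        ≈⟨ θ-* _ _ ⟩
      θ (e (suc k)) * x ^ suc k + e (suc k) * θ (x ^ suc k)
        ≈⟨ +-cong (trans (*-congʳ (θe≈0 (suc k))) (zeroˡ _)) (*-congˡ (θ-^ x k)) ⟩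
      0# + e (suc k) * (suc k ×ₙ (θ x * x ^ k))
        ≈⟨ +-identityˡ _ ⟩
      e (suc k) * (suc k ×ₙ (θ x * x ^ k))
        ≈⟨ ×-comm-* (suc k) _ _ ⟩
      suc k ×ₙ (e (suc k) * (θ x * x ^ k))
        ≈⟨ ×-assoc-* (suc k) _ _ ⟨
      (suc k ×ₙ e (suc k)) * (θ x * x ^ k)
        ≈⟨ *-congʳ (e-suc k) ⟩
      (t * e k) * (θ x * x ^ k)
        ≈⟨ *-assoc t (e k) _ ⟩
      t * (e k * (θ x * x ^ k))
        ≈⟨ *-congˡ (x∙yz≈y∙xz (e k) (θ x) (x ^ k)) ⟩
      t * (θ x * (e k * x ^ k)) ∎

  -- Meant for `x` = ln(1 + `ƛ`), `u` = 1 + `ƛ` and `y` = `ƛ`: the factor `u` clears the denominator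
  -- of θ `x`, so 1 + `ƛ` never has to be inverted.
  *-θ-exp : ∀ e t → (∀ k → θ (e k) ≈ 0#) → (∀ k → suc k ×ₙ e (suc k) ≈ t * e k) →
            ∀ {u x y} → u * θ x ≈ y →
            ∀ n → u * θ (partialSum e x (suc n)) ≈ t * (y * partialSum e x n)
  *-θ-exp e t θe≈0 e-suc {u} {x} {y} u*θx≈y n = begin
    u * θ (partialSum e x (suc n))      ≈⟨ *-congˡ (θ-exp e t θe≈0 e-suc x n) ⟩
    u * (t * (θ x * partialSum e x n))  ≈⟨ x∙yz≈y∙xz u t _ ⟩
    t * (u * (θ x * partialSum e x n))  ≈⟨ *-congˡ (*-assoc u (θ x) _) ⟨
    t * (u * θ x * partialSum e x n)    ≈⟨ *-congˡ (*-congʳ u*θx≈y) ⟩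
    t * (y * partialSum e x n)          ∎

-- Power series

module SeriesRing (R : CommutativeRing c ℓ) where

  open CommutativeRing R
  open SemiringSum semiring
  open SemiringMult semiring using (×-congʳ; ×-congˡ; ×-homo-+; ×-comm-*; ×-assoc-*)
    renaming (_×_ to _×ₙ_)
  open CommutativeMonoidMult +-commutativeMonoid using (×-distrib-+)
  open CommutativeSemigroupProperties +-commutativeSemigroup
    using () renaming (x∙yz≈y∙xz to x+[y+z]≈y+[x+z])
  open SetoidReasoning setoid
  module PS = PowerSeries rawRing
  open PS using (constant; ƛ)

  Series : Set c
  Series = ℕ → Carrier

  summand : Series → Series → ∀ n → Fin (suc n) → Carrier
  summand f g n i = f (toℕ i) * g (n ℕ.∸ toℕ i)

  infixl 7 _⊛_
  -- The sum unfolds definitionally: coefficient `suc n` of `f ⊛ g` is `f 0 * g (suc n)` plus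
  -- coefficient `n` of `f ∘ suc ⊛ g`. The inductions below rest on peeling off the left factor in
  -- this way.
  _⊛_ : Series → Series → Series
  f ⊛ g = λ n → sum (summand f g n)

  ⊛-cong : ∀ {f f′ g g′} → (∀ n → f n ≈ f′ n) → (∀ n → g n ≈ g′ n) →
           ∀ n → (f ⊛ g) n ≈ (f′ ⊛ g′) n
  ⊛-cong p q zero    = +-congʳ (*-cong (p 0) (q 0))
  ⊛-cong {g = g} p q (suc n) = +-cong (*-cong (p 0) (q (suc n))) (⊛-cong {g = g} (p ∘ suc) q n)

  ⊛-zero : ∀ f g → (f ⊛ g) 0 ≈ f 0 * g 0
  ⊛-zero f g = +-identityʳ _

  ⊛-distribˡ : ∀ f g h n → (f ⊛ (λ m → g m + h m)) n ≈ (f ⊛ g) n + (f ⊛ h) n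
  ⊛-distribˡ f g h n = trans
    (sum-cong-≋ {suc n} λ i → distribˡ (f (toℕ i)) (g (n ℕ.∸ toℕ i)) (h (n ℕ.∸ toℕ i)))
    (∑-distrib-+ (summand f g n) (summand f h n))

  -- Mirror image of the definitional unfolding, peeling the right factor instead. Commutativity
  -- follows by matching the two.
  ⊛-suc′ : ∀ f g n → (f ⊛ g) (suc n) ≈ f (suc n) * g 0 + (f ⊛ (g ∘ suc)) n
  ⊛-suc′ f g zero    = x+[y+z]≈y+[x+z] _ _ _
  ⊛-suc′ f g (suc n) = trans (+-congˡ (⊛-suc′ (f ∘ suc) g n)) (x+[y+z]≈y+[x+z] _ _ _)

  ⊛-comm : ∀ f g n → (f ⊛ g) n ≈ (g ⊛ f) n
  ⊛-comm f g zero    = +-congʳ (*-comm (f 0) (g 0))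
  ⊛-comm f g (suc n) = begin
    f 0 * g (suc n) + (f ∘ suc ⊛ g) n  ≈⟨ +-cong (*-comm _ _) (⊛-comm (f ∘ suc) g n) ⟩
    g (suc n) * f 0 + (g ⊛ f ∘ suc) n  ≈⟨ ⊛-suc′ g f n ⟨
    (g ⊛ f) (suc n)                    ∎

  ⊛-distribʳ : ∀ f g h n → ((λ m → g m + h m) ⊛ f) n ≈ (g ⊛ f) n + (h ⊛ f) n
  ⊛-distribʳ f g h n = trans (⊛-comm (λ m → g m + h m) f n) (trans (⊛-distribˡ f g h n)
    (+-cong (⊛-comm f g n) (⊛-comm f h n)))

  scale-⊛ : ∀ a f g n → ((λ m → a * f m) ⊛ g) n ≈ a * (f ⊛ g) n
  scale-⊛ a f g n = trans
    (sum-cong-≋ {suc n} λ i → *-assoc a (f (toℕ i)) (g (n ℕ.∸ toℕ i)))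
    (sym (*-distribˡ-sum a (summand f g n)))

  ⊛-assoc : ∀ f g h n → ((f ⊛ g) ⊛ h) n ≈ (f ⊛ (g ⊛ h)) n
  ⊛-assoc f g h zero    = begin
    ((f ⊛ g) ⊛ h) 0    ≈⟨ ⊛-zero (f ⊛ g) h ⟩
    (f ⊛ g) 0 * h 0    ≈⟨ *-congʳ (⊛-zero f g) ⟩
    f 0 * g 0 * h 0    ≈⟨ *-assoc _ _ _ ⟩
    f 0 * (g 0 * h 0)  ≈⟨ *-congˡ (⊛-zero g h) ⟨
    f 0 * (g ⊛ h) 0    ≈⟨ ⊛-zero f (g ⊛ h) ⟨
    (f ⊛ (g ⊛ h)) 0    ∎
  ⊛-assoc f g h (suc n) = begin
    (f ⊛ g) 0 * h (suc n) + ((f ⊛ g) ∘ suc ⊛ h) n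
      ≈⟨ +-cong (*-congʳ (⊛-zero f g)) (⊛-distribʳ h (λ m → f 0 * g (suc m)) (f ∘ suc ⊛ g) n) ⟩
    f 0 * g 0 * h (suc n) + (((λ m → f 0 * g (suc m)) ⊛ h) n + ((f ∘ suc ⊛ g) ⊛ h) n)
      ≈⟨ +-cong (*-assoc _ _ _) (+-cong (scale-⊛ (f 0) (g ∘ suc) h n) (⊛-assoc (f ∘ suc) g h n)) ⟩
    f 0 * (g 0 * h (suc n)) + (f 0 * (g ∘ suc ⊛ h) n + (f ∘ suc ⊛ (g ⊛ h)) n)
      ≈⟨ +-assoc _ _ _ ⟨
    f 0 * (g 0 * h (suc n)) + f 0 * (g ∘ suc ⊛ h) n + (f ∘ suc ⊛ (g ⊛ h)) n
      ≈⟨ +-congʳ (distribˡ _ _ _) ⟨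
    f 0 * (g ⊛ h) (suc n) + (f ∘ suc ⊛ (g ⊛ h)) n  ∎

  0⊛ : ∀ f n → ((λ _ → 0#) ⊛ f) n ≈ 0#
  0⊛ f n = trans (sum-cong-≋ {suc n} λ i → zeroˡ (f (n ℕ.∸ toℕ i))) (sum-replicate-zero (suc n))

  constant-⊛ : ∀ a f n → (constant a ⊛ f) n ≈ a * f n
  constant-⊛ a f zero    = ⊛-zero (constant a) f
  constant-⊛ a f (suc n) = trans (+-congˡ (0⊛ f n)) (+-identityʳ _)

  ƛ-⊛ : ∀ f n → (ƛ ⊛ f) (suc n) ≈ f n
  ƛ-⊛ f n = begin
    0# * f (suc n) + (ƛ ∘ suc ⊛ f) n  ≈⟨ +-cong (zeroˡ _) (⊛-cong {g = f} ƛ∘suc (λ _ → refl) n) ⟩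
    0# + (constant 1# ⊛ f) n          ≈⟨ +-identityˡ _ ⟩
    (constant 1# ⊛ f) n               ≈⟨ constant-⊛ 1# f n ⟩
    1# * f n                          ≈⟨ *-identityˡ _ ⟩
    f n                               ∎
    where
    ƛ∘suc : ∀ m → ƛ (suc m) ≈ constant 1# m
    ƛ∘suc zero    = refl
    ƛ∘suc (suc m) = refl

  ƛ-⊛-zero : ∀ f → (ƛ ⊛ f) 0 ≈ 0#
  ƛ-⊛-zero f = trans (⊛-zero ƛ f) (zeroˡ _)

  ⊛-identityˡ : ∀ f n → (constant 1# ⊛ f) n ≈ f n
  ⊛-identityˡ f n = trans (constant-⊛ 1# f n) (*-identityˡ (f n))

  seriesRing : CommutativeRing c ℓ
  seriesRing = record
    { RawRing PS.powerSeriesRing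
    ; isCommutativeRing = record
      { isRing = record
        { +-isAbelianGroup = Pointwise.isAbelianGroup ℕ +-isAbelianGroup
        ; *-cong           = λ {f} {f′} {g} → ⊛-cong {f} {f′} {g}
        ; *-assoc          = ⊛-assoc
        ; *-identity       = ⊛-identityˡ , λ f n → trans (⊛-comm f (constant 1#) n) (⊛-identityˡ f n)
        ; distrib          = ⊛-distribˡ , ⊛-distribʳ
        }
      ; *-comm = ⊛-comm
      }
    }

  module Series = CommutativeRing seriesRing

  -- θ = x d/dx
  θ : Series → Series
  θ f n = n ×ₙ f n

  ×-sum : ∀ {m} n (t : Fin m → Carrier) → n ×ₙ sum t ≈ sum (λ i → n ×ₙ t i)
  ×-sum {zero}  n t = begin
    n ×ₙ 0#         ≈⟨ ×-congʳ n (zeroˡ 0#) ⟨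
    n ×ₙ (0# * 0#)  ≈⟨ ×-comm-* n 0# 0# ⟨
    0# * (n ×ₙ 0#)  ≈⟨ zeroˡ _ ⟩
    0#              ∎
  ×-sum {suc m} n t = trans (×-distrib-+ _ _ n) (+-congˡ (×-sum n (t ∘ suc)))

  -- A summand of coefficient `n` has degree i in one factor and n - i in the other, and the
  -- multiple by n splits accordingly. The bound i ≤ n keeps the truncated subtraction exact.
  θ-⊛ : ∀ f g → θ (f Series.* g) Series.≈ θ f Series.* g Series.+ f Series.* θ g
  θ-⊛ f g n = begin
    n ×ₙ (f ⊛ g) n
      ≈⟨ ×-sum n (summand f g n) ⟩
    sum (λ i → n ×ₙ summand f g n i)
      ≈⟨ sum-cong-≋ {suc n} (λ i → leibniz (toℕ i) (Fin.toℕ≤pred[n] i)) ⟩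
    sum (λ i → summand (θ f) g n i + summand f (θ g) n i)
      ≈⟨ ∑-distrib-+ (summand (θ f) g n) (summand f (θ g) n) ⟩
    (θ f ⊛ g) n + (f ⊛ θ g) n ∎
    where
    leibniz : ∀ i → i ℕ.≤ n →
              n ×ₙ (f i * g (n ℕ.∸ i)) ≈ θ f i * g (n ℕ.∸ i) + f i * θ g (n ℕ.∸ i)
    leibniz i i≤n = begin
      n ×ₙ (f i * g (n ℕ.∸ i))
        ≈⟨ ×-congˡ (≡.sym (ℕ.m+[n∸m]≡n i≤n)) ⟩
      (i ℕ.+ (n ℕ.∸ i)) ×ₙ (f i * g (n ℕ.∸ i))
        ≈⟨ ×-homo-+ _ i (n ℕ.∸ i) ⟩
      i ×ₙ (f i * g (n ℕ.∸ i)) + (n ℕ.∸ i) ×ₙ (f i * g (n ℕ.∸ i))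
        ≈⟨ +-cong (×-assoc-* i _ _) (×-comm-* (n ℕ.∸ i) _ _) ⟨
      θ f i * g (n ℕ.∸ i) + f i * θ g (n ℕ.∸ i) ∎

  θ-isDerivation : IsDerivation seriesRing θ
  θ-isDerivation = record
    { θ-cong = λ f≈g n → ×-congʳ n (f≈g n)
    ; θ-+    = λ f g n → ×-distrib-+ (f n) (g n) n
    ; θ-*    = θ-⊛
    }

  θ-constant : ∀ a → θ (constant a) Series.≈ Series.0#
  θ-constant a zero    = refl
  -- The empty-sum case of `×-sum` says that multiples of `0#` vanish.
  θ-constant a (suc n) = ×-sum {0} (suc n) λ ()

-- Coefficients of 1 + x and orders of vanishing

module SeriesCoefficients (R : CommutativeRing c ℓ) where

  open CommutativeRing R hiding (zero)
  open SemiringSum semiring using (sum)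
  open SemiringMult semiring using (×-congʳ) renaming (_×_ to _×ₙ_)
  open SeriesRing R
  open PowerSeries rawRing using (constant; ƛ)
  open SetoidReasoning setoid

  private
    module Mult = SemiringMult Series.semiring
    module Exp = SemiringExp Series.semiring
    module Sum = SemiringSum Series.semiring

  1+ƛ : Series
  1+ƛ = Series.1# Series.+ ƛ

  1+ƛ-⊛-zero : ∀ f → (1+ƛ ⊛ f) 0 ≈ f 0
  1+ƛ-⊛-zero f = begin
    (1+ƛ ⊛ f) 0      ≈⟨ ⊛-zero 1+ƛ f ⟩
    (1# + 0#) * f 0  ≈⟨ *-congʳ (+-identityʳ 1#) ⟩
    1# * f 0         ≈⟨ *-identityˡ _ ⟩
    f 0              ∎

  1+ƛ-⊛-suc : ∀ f n → (1+ƛ ⊛ f) (suc n) ≈ f (suc n) + f n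
  1+ƛ-⊛-suc f n = trans (⊛-distribʳ f Series.1# ƛ (suc n))
    (+-cong (⊛-identityˡ f (suc n)) (ƛ-⊛ f n))

  1+ƛ-^-zero : ∀ n → (1+ƛ Exp.^ n) 0 ≈ 1#
  1+ƛ-^-zero zero    = refl
  1+ƛ-^-zero (suc n) = trans (1+ƛ-⊛-zero (1+ƛ Exp.^ n)) (1+ƛ-^-zero n)

  θ-1+ƛ : θ 1+ƛ Series.≈ ƛ
  θ-1+ƛ zero          = refl
  θ-1+ƛ (suc zero)    = trans (+-identityʳ _) (+-identityˡ 1#)
  θ-1+ƛ (suc (suc n)) = trans (×-congʳ (suc (suc n)) (+-identityʳ 0#))
    (θ-constant 0# (suc (suc n)))

  ×-coefficient : ∀ k f n → (k Mult.× f) n ≡ k ×ₙ f n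
  ×-coefficient zero    f n = ≡.refl
  ×-coefficient (suc k) f n = ≡.cong (f n +_) (×-coefficient k f n)

  sum-coefficient : ∀ {k} (t : Fin k → Series) n → Sum.sum t n ≡ sum (λ i → t i n)
  sum-coefficient {zero}  t n = ≡.refl
  sum-coefficient {suc k} t n = ≡.cong (t zero n +_) (sum-coefficient (t ∘ suc) n)

  ⊛-order : ∀ {k} f → (∀ m → m ℕ.< k → f m ≈ 0#) → ∀ g m → m ℕ.< k → (g ⊛ f) m ≈ 0#
  ⊛-order f f≈0 g zero    m<k = trans (⊛-zero g f) (trans (*-congˡ (f≈0 0 m<k)) (zeroʳ _))
  ⊛-order f f≈0 g (suc m) m<k = trans
    (+-cong (trans (*-congˡ (f≈0 (suc m) m<k)) (zeroʳ _))
            (⊛-order f f≈0 (g ∘ suc) m (ℕ.<-trans (ℕ.n<1+n m) m<k)))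
    (+-identityˡ 0#)

  -- Each factor contributes at least one power of the variable. For the logarithm this makes the
  -- omitted high powers in a truncated exponential invisible in low degrees.
  ^-order : ∀ {f} → f 0 ≈ 0# → ∀ k m → m ℕ.< k → (f Exp.^ k) m ≈ 0#
  ^-order {f} f₀≈0 (suc k) zero    _         = trans (⊛-zero f (f Exp.^ k)) (trans (*-congʳ f₀≈0) (zeroˡ _))
  ^-order {f} f₀≈0 (suc k) (suc m) (s≤s m<k) = trans
    (+-cong (trans (*-congʳ f₀≈0) (zeroˡ _))
            (⊛-order (f Exp.^ k) (^-order f₀≈0 k) (f ∘ suc) m m<k))
    (+-identityˡ 0#)

-- Algebras and matrices

-- Instantiated twice: by matrices over ℚ, in which series are evaluated, and by matrices over
-- ℚ[[λ]], in which the resolvents live.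
record IsAssociativeAlgebra (R : CommutativeRing c ℓ) (S : Ring c′ ℓ′)
  (_•_ : CommutativeRing.Carrier R → Ring.Carrier S → Ring.Carrier S) :
  Set (c ⊔ ℓ ⊔ c′ ⊔ ℓ′) where
  private
    module R = CommutativeRing R
    module S = Ring S
  field
    •-cong      : ∀ {a b x y} → a R.≈ b → x S.≈ y → (a • x) S.≈ (b • y)
    •-distribˡ  : ∀ a x y → (a • (x S.+ y)) S.≈ (a • x) S.+ (a • y)
    •-distribʳ  : ∀ x a b → ((a R.+ b) • x) S.≈ (a • x) S.+ (b • x)
    •-assoc     : ∀ a b x → ((a R.* b) • x) S.≈ (a • (b • x))
    •-identityˡ : ∀ x → (R.1# • x) S.≈ x
    •-*-assoc   : ∀ a x y → ((a • x) S.* y) S.≈ (a • (x S.* y))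
    •-*-comm    : ∀ a x y → (x S.* (a • y)) S.≈ (a • (x S.* y))

module AlgebraProperties (R : CommutativeRing c ℓ) (S : Ring c′ ℓ′)
  {_•_ : CommutativeRing.Carrier R → Ring.Carrier S → Ring.Carrier S}
  (isAlgebra : IsAssociativeAlgebra R S _•_)
  where

  private
    module R = CommutativeRing R

  open Ring S
  open IsAssociativeAlgebra isAlgebra
  open RingProperties S using (x+x≈x⇒x≈0)

  infixr 8 _·_
  _·_ : R.Carrier → Carrier → Carrier
  _·_ = _•_

  ·-zero : ∀ r → r · 0# ≈ 0#
  ·-zero r = x+x≈x⇒x≈0 _ (trans (sym (•-distribˡ r 0# 0#)) (•-cong R.refl (+-identityˡ 0#)))

  zero-· : ∀ x → R.0# · x ≈ 0#
  zero-· x = x+x≈x⇒x≈0 _ (trans (sym (•-distribʳ x R.0# R.0#)) (•-cong (R.+-identityˡ R.0#) refl))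

-- Matrices over a commutative ring as an associative algebra

module MatrixRing (R : CommutativeRing c ℓ) {X : Set} {N : ℕ} (enum : Fin N ↔ X) where

  open CommutativeRing R hiding (zero)
  open SemiringSum semiring
  open SetoidReasoning setoid
  open Inverse enum using (to; from; strictlyInverseˡ; strictlyInverseʳ)
  open Matrices rawRing enum

  private
    module M = RawRing matrixRing

  δ : ∀ {n} → Fin n → Fin n → Carrier
  δ i j = if does (i Fin.≟ j) then 1# else 0#

  δ-suc : ∀ {n} (i j : Fin n) → δ (suc i) (suc j) ≈ δ i j
  δ-suc i j with i Fin.≟ j
  ... | yes _ = refl
  ... | no  _ = refl

  δ-sym : ∀ {n} (i j : Fin n) → δ i j ≈ δ j i
  δ-sym i j with i Fin.≟ j | j Fin.≟ i
  ... | yes _ | yes _ = refl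
  ... | no  _ | no  _ = refl
  ... | yes i≡j | no j≢i = contradiction (≡.sym i≡j) j≢i
  ... | no i≢j | yes j≡i = contradiction (≡.sym j≡i) i≢j

  sum-δ : ∀ {n} i (t : Fin n → Carrier) → sum (λ j → δ i j * t j) ≈ t i
  sum-δ {suc n} zero    t = begin
    1# * t zero + sum (λ j → 0# * t (suc j))  ≈⟨ +-cong (*-identityˡ _) (sum-cong-≋ {n} λ j → zeroˡ (t (suc j))) ⟩
    t zero + sum {n} (λ _ → 0#)               ≈⟨ +-congˡ (sum-replicate-zero n) ⟩
    t zero + 0#                               ≈⟨ +-identityʳ _ ⟩
    t zero                                    ∎
  sum-δ (suc i) t = begin
    0# * t zero + sum (λ j → δ (suc i) (suc j) * t (suc j))
      ≈⟨ +-cong (zeroˡ _) (sum-cong-≋ λ j → *-congʳ (δ-suc i j)) ⟩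
    0# + sum (λ j → δ i j * t (suc j))  ≈⟨ +-identityˡ _ ⟩
    sum (λ j → δ i j * t (suc j))       ≈⟨ sum-δ i (t ∘ suc) ⟩
    t (suc i)                           ∎

  -- `identity` compares positions in the enumeration, so equality on `X` itself need not be
  -- decided; at an enumerated index the position is `k`.
  identity-to : ∀ x k → identity x (to k) ≈ δ (from x) k
  identity-to x k = reflexive (≡.cong (δ (from x)) (strictlyInverseʳ k))

  *-identityˡ′ : ∀ M → (identity M.* M) M.≈ M
  *-identityˡ′ M x y = begin
    sum (λ k → identity x (to k) * M (to k) y)  ≈⟨ sum-cong-≋ (λ k → *-congʳ (identity-to x k)) ⟩
    sum (λ k → δ (from x) k * M (to k) y)       ≈⟨ sum-δ (from x) (λ k → M (to k) y) ⟩
    M (to (from x)) y                           ≡⟨ ≡.cong (λ z → M z y) (strictlyInverseˡ x) ⟩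
    M x y                                       ∎

  *-identityʳ′ : ∀ M → (M M.* identity) M.≈ M
  *-identityʳ′ M x y = begin
    sum (λ k → M x (to k) * identity (to k) y)  ≈⟨ sum-cong-≋ swap ⟩
    sum (λ k → δ (from y) k * M x (to k))       ≈⟨ sum-δ (from y) (λ k → M x (to k)) ⟩
    M x (to (from y))                           ≡⟨ ≡.cong (M x) (strictlyInverseˡ y) ⟩
    M x y                                       ∎
    where
    swap : ∀ k → M x (to k) * identity (to k) y ≈ δ (from y) k * M x (to k)
    swap k = trans (*-comm _ _)
      (*-congʳ (trans (δ-sym (from (to k)) (from y)) (identity-to y k)))

  *-assoc′ : ∀ L M M′ → ((L M.* M) M.* M′) M.≈ (L M.* (M M.* M′))
  *-assoc′ L M M′ x y = begin
    sum (λ k → sum (λ l → L x (to l) * M (to l) (to k)) * M′ (to k) y)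
      ≈⟨ sum-cong-≋ (λ k → *-distribʳ-sum (M′ (to k) y) (λ l → L x (to l) * M (to l) (to k))) ⟩
    sum (λ k → sum (λ l → L x (to l) * M (to l) (to k) * M′ (to k) y))
      ≈⟨ ∑-comm (λ k l → L x (to l) * M (to l) (to k) * M′ (to k) y) ⟩
    sum (λ l → sum (λ k → L x (to l) * M (to l) (to k) * M′ (to k) y))
      ≈⟨ sum-cong-≋ {N} (λ l → sum-cong-≋ {N} (λ k → *-assoc (L x (to l)) (M (to l) (to k)) (M′ (to k) y))) ⟩
    sum (λ l → sum (λ k → L x (to l) * (M (to l) (to k) * M′ (to k) y)))
      ≈⟨ sum-cong-≋ (λ l → *-distribˡ-sum (L x (to l)) (λ k → M (to l) (to k) * M′ (to k) y)) ⟨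
    sum (λ l → L x (to l) * sum (λ k → M (to l) (to k) * M′ (to k) y)) ∎

  matrices : Ring c ℓ
  matrices = record
    { RawRing matrixRing
    ; isRing = record
      { +-isAbelianGroup = Pointwise.isAbelianGroup X (Pointwise.isAbelianGroup X +-isAbelianGroup)
      ; *-cong           = λ p q x y → sum-cong-≋ λ k → *-cong (p x (to k)) (q (to k) y)
      ; *-assoc          = *-assoc′
      ; *-identity       = *-identityˡ′ , *-identityʳ′
      ; distrib          = (λ L M M′ x y → trans (sum-cong-≋ {N} λ k → distribˡ (L x (to k)) (M (to k) y) (M′ (to k) y))
                             (∑-distrib-+ (λ k → L x (to k) * M (to k) y) (λ k → L x (to k) * M′ (to k) y)))
                         , (λ L M M′ x y → trans (sum-cong-≋ {N} λ k → distribʳ (L (to k) y) (M x (to k)) (M′ x (to k)))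
                             (∑-distrib-+ (λ k → M x (to k) * L (to k) y) (λ k → M′ x (to k) * L (to k) y)))
      }
    }

  isAssociativeAlgebra : IsAssociativeAlgebra R matrices _•_
  isAssociativeAlgebra = record
    { •-cong      = λ p q x y → *-cong p (q x y)
    ; •-distribˡ  = λ a M M′ x y → distribˡ a (M x y) (M′ x y)
    ; •-distribʳ  = λ M a b x y → distribʳ (M x y) a b
    ; •-assoc     = λ a b M x y → *-assoc a b (M x y)
    ; •-identityˡ = λ M x y → *-identityˡ (M x y)
    ; •-*-assoc   = λ a M M′ x y → trans (sum-cong-≋ {N} λ k → *-assoc a (M x (to k)) (M′ (to k) y))
                      (sym (*-distribˡ-sum a (λ k → M x (to k) * M′ (to k) y)))
    ; •-*-comm    = λ a M M′ x y → trans (sum-cong-≋ {N} λ k → x∙yz≈y∙xz (M x (to k)) a (M′ (to k) y))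
                      (sym (*-distribˡ-sum a (λ k → M x (to k) * M′ (to k) y)))
    }
    where open import Algebra.Properties.CommutativeSemigroup *-commutativeSemigroup using (x∙yz≈y∙xz)

-- Evaluation at a nilpotent element

module Evaluation (R : CommutativeRing c ℓ) (S : Ring c′ ℓ′)
  {_•_ : CommutativeRing.Carrier R → Ring.Carrier S → Ring.Carrier S}
  (isAlgebra : IsAssociativeAlgebra R S _•_) (a : Ring.Carrier S)
  where

  private
    module R = CommutativeRing R

  open Ring S hiding (zero)
  open IsAssociativeAlgebra isAlgebra
  open SemiringExp semiring using (_^_)
  open SemiringSum semiring
  open SeriesRing R using (Series; _⊛_; module Series; ⊛-zero)
  open PowerSeries R.rawRing using (constant; ƛ)
  open AlgebraProperties R S isAlgebra
  open CommutativeSemigroupProperties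
    (CommutativeMonoid.commutativeSemigroup +-commutativeMonoid) using (interchange)
  open SetoidReasoning setoid

  -- Horner's scheme for Σ_{m<n} f m • aᵐ.
  ev : ℕ → Series → Carrier
  ev zero    f = 0#
  ev (suc n) f = f 0 · 1# + ev n (f ∘ suc) * a

  -- Agreement is demanded only below the length, since the exponential and binomial series are
  -- compared only that far.
  ev-cong : ∀ n {f g} → (∀ m → m ℕ.< n → f m R.≈ g m) → ev n f ≈ ev n g
  ev-cong zero    f≈g = refl
  ev-cong (suc n) f≈g = +-cong (•-cong (f≈g 0 (s≤s z≤n)) refl)
    (*-congʳ (ev-cong n λ m m<n → f≈g (suc m) (s≤s m<n)))

  ev-+ : ∀ n f g → ev n (f Series.+ g) ≈ ev n f + ev n g
  ev-+ zero    f g = sym (+-identityˡ 0#)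
  ev-+ (suc n) f g = begin
    (f 0 R.+ g 0) · 1# + ev n ((f ∘ suc) Series.+ (g ∘ suc)) * a
      ≈⟨ +-cong (•-distribʳ 1# _ _) (trans (*-congʳ (ev-+ n _ _)) (distribʳ a _ _)) ⟩
    (f 0 · 1# + g 0 · 1#) + (ev n (f ∘ suc) * a + ev n (g ∘ suc) * a)
      ≈⟨ interchange _ _ _ _ ⟩
    ev (suc n) f + ev (suc n) g ∎

  ev-scale : ∀ n r f → ev n (λ m → r R.* f m) ≈ r · ev n f
  ev-scale zero    r f = sym (·-zero r)
  ev-scale (suc n) r f = begin
    (r R.* f 0) · 1# + ev n (λ m → r R.* f (suc m)) * a
      ≈⟨ +-cong (•-assoc r (f 0) 1#) (*-congʳ (ev-scale n r (f ∘ suc))) ⟩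
    r · f 0 · 1# + r · ev n (f ∘ suc) * a
      ≈⟨ +-congˡ (•-*-assoc r (ev n (f ∘ suc)) a) ⟩
    r · f 0 · 1# + r · (ev n (f ∘ suc) * a)
      ≈⟨ •-distribˡ r _ _ ⟨
    r · ev (suc n) f ∎

  ev-0 : ∀ n → ev n Series.0# ≈ 0#
  ev-0 zero    = refl
  ev-0 (suc n) = trans (+-cong (zero-· 1#) (trans (*-congʳ (ev-0 n)) (zeroˡ a))) (+-identityˡ 0#)

  ev-constant : ∀ n r → ev (suc n) (constant r) ≈ r · 1#
  ev-constant n r = trans (+-congˡ (trans (*-congʳ (ev-0 n)) (zeroˡ a))) (+-identityʳ _)

  -- `S` need not be commutative, but polynomials in `a` commute with `a`. The product rule uses
  -- this to carry `a` past the second factor.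
  ev-comm : ∀ n f → a * ev n f ≈ ev n f * a
  ev-comm zero    f = trans (zeroʳ a) (sym (zeroˡ a))
  ev-comm (suc n) f = begin
    a * (f 0 · 1# + ev n (f ∘ suc) * a)
      ≈⟨ distribˡ a _ _ ⟩
    a * f 0 · 1# + a * (ev n (f ∘ suc) * a)
      ≈⟨ +-cong scalar (sym (*-assoc _ _ _)) ⟩
    f 0 · 1# * a + (a * ev n (f ∘ suc)) * a
      ≈⟨ +-congˡ (*-congʳ (ev-comm n (f ∘ suc))) ⟩
    f 0 · 1# * a + ev n (f ∘ suc) * a * a
      ≈⟨ distribʳ a _ _ ⟨
    ev (suc n) f * a ∎
    where
    scalar : a * f 0 · 1# ≈ f 0 · 1# * a
    scalar = begin
      a * f 0 · 1#    ≈⟨ •-*-comm (f 0) a 1# ⟩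
      f 0 · (a * 1#)  ≈⟨ •-cong R.refl (trans (*-identityʳ a) (sym (*-identityˡ a))) ⟩
      f 0 · (1# * a)  ≈⟨ •-*-assoc (f 0) 1# a ⟨
      f 0 · 1# * a    ∎

  ^-comm : ∀ n → a ^ n * a ≈ a * a ^ n
  ^-comm zero    = trans (*-identityˡ a) (sym (*-identityʳ a))
  ^-comm (suc n) = trans (*-assoc a _ a) (*-congˡ (^-comm n))

  ev≈sum : ∀ n f → ev n f ≈ sum {n} (λ i → f (toℕ i) · a ^ toℕ i)
  ev≈sum zero    f = refl
  ev≈sum (suc n) f = +-congˡ (begin
    ev n (f ∘ suc) * a
      ≈⟨ *-congʳ (ev≈sum n (f ∘ suc)) ⟩
    sum {n} (λ i → f (suc (toℕ i)) · a ^ toℕ i) * a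
      ≈⟨ *-distribʳ-sum {n} a _ ⟩
    sum {n} (λ i → f (suc (toℕ i)) · a ^ toℕ i * a)
      ≈⟨ sum-cong-≋ {n} (λ i → trans (•-*-assoc _ _ a) (•-cong R.refl (^-comm (toℕ i)))) ⟩
    sum {n} (λ i → f (suc (toℕ i)) · a ^ suc (toℕ i)) ∎)

  -- One step of Horner's scheme moves its trailing `a` into the accumulated power.
  ev-suc-*-^ : ∀ n j f → ev (suc n) f * a ^ j ≈ f 0 · a ^ j + ev n (f ∘ suc) * a ^ suc j
  ev-suc-*-^ n j f = begin
    (f 0 · 1# + ev n (f ∘ suc) * a) * a ^ j
      ≈⟨ distribʳ _ _ _ ⟩
    f 0 · 1# * a ^ j + ev n (f ∘ suc) * a * a ^ j
      ≈⟨ +-cong (trans (•-*-assoc (f 0) 1# _) (•-cong R.refl (*-identityˡ _))) (*-assoc _ a _) ⟩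
    f 0 · a ^ j + ev n (f ∘ suc) * a ^ suc j ∎

  shift : ∀ n j → a ^ (suc n ℕ.+ j) ≈ 0# → a ^ (n ℕ.+ suc j) ≈ 0#
  shift n j = trans (reflexive (≡.cong (a ^_) (ℕ.+-suc n j)))

  -- The longer sum has one extra term, `f n` times `a ^ (n + j)`, which is zero.
  ev-suc : ∀ n j → a ^ (n ℕ.+ j) ≈ 0# → ∀ f → ev (suc n) f * a ^ j ≈ ev n f * a ^ j
  ev-suc zero    j aʲ≈0 f = trans (*-congˡ aʲ≈0) (trans (zeroʳ _) (sym (zeroˡ _)))
  ev-suc (suc n) j eq   f = begin
    ev (suc (suc n)) f * a ^ j
      ≈⟨ ev-suc-*-^ (suc n) j f ⟩
    f 0 · a ^ j + ev (suc n) (f ∘ suc) * a ^ suc j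
      ≈⟨ +-congˡ (ev-suc n (suc j) (shift n j eq) (f ∘ suc)) ⟩
    f 0 · a ^ j + ev n (f ∘ suc) * a ^ suc j
      ≈⟨ ev-suc-*-^ n j f ⟨
    ev (suc n) f * a ^ j ∎

  -- Carrying the factor aʲ turns nilpotency into a statement on which one
  -- can induct: each step of Horner's scheme trades n for j.
  ev-⊛-^ : ∀ n j → a ^ (n ℕ.+ j) ≈ 0# → ∀ f g →
           ev n (f ⊛ g) * a ^ j ≈ ev n f * ev n g * a ^ j
  ev-⊛-^ zero    j eq f g = *-congʳ (sym (zeroˡ 0#))
  ev-⊛-^ (suc n) j eq f g = begin
    ev (suc n) (f ⊛ g) * a ^ j
      ≈⟨ ev-suc-*-^ n j (f ⊛ g) ⟩
    (f ⊛ g) 0 · a ^ j + ev n ((f ⊛ g) ∘ suc) * a ^ suc j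
      ≈⟨ +-cong (trans (•-cong (⊛-zero f g) refl) (•-assoc _ _ _))
                (trans (*-congʳ (ev-+ n (λ m → f 0 R.* g (suc m)) ((f ∘ suc) ⊛ g))) (distribʳ _ _ _)) ⟩
    f 0 · g 0 · a ^ j + (ev n (λ m → f 0 R.* g (suc m)) * a ^ suc j + ev n ((f ∘ suc) ⊛ g) * a ^ suc j)
      ≈⟨ +-assoc _ _ _ ⟨
    f 0 · g 0 · a ^ j + ev n (λ m → f 0 R.* g (suc m)) * a ^ suc j + ev n ((f ∘ suc) ⊛ g) * a ^ suc j
      ≈⟨ +-cong head tail ⟩
    f 0 · (ev (suc n) g * a ^ j) + ev n (f ∘ suc) * a * ev (suc n) g * a ^ j
      ≈⟨ +-congʳ scalar ⟨
    f 0 · 1# * ev (suc n) g * a ^ j + ev n (f ∘ suc) * a * ev (suc n) g * a ^ j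
      ≈⟨ distribʳ _ _ _ ⟨
    (f 0 · 1# * ev (suc n) g + ev n (f ∘ suc) * a * ev (suc n) g) * a ^ j
      ≈⟨ *-congʳ (distribʳ _ _ _) ⟨
    ev (suc n) f * ev (suc n) g * a ^ j ∎
    where
    eq′ = shift n j eq

    scalar : f 0 · 1# * ev (suc n) g * a ^ j ≈ f 0 · (ev (suc n) g * a ^ j)
    scalar = begin
      f 0 · 1# * ev (suc n) g * a ^ j    ≈⟨ *-congʳ (•-*-assoc (f 0) 1# _) ⟩
      f 0 · (1# * ev (suc n) g) * a ^ j  ≈⟨ •-*-assoc (f 0) _ _ ⟩
      f 0 · (1# * ev (suc n) g * a ^ j)  ≈⟨ •-cong R.refl (*-congʳ (*-identityˡ _)) ⟩
      f 0 · (ev (suc n) g * a ^ j)       ∎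

    head : f 0 · g 0 · a ^ j + ev n (λ m → f 0 R.* g (suc m)) * a ^ suc j ≈
           f 0 · (ev (suc n) g * a ^ j)
    head = begin
      f 0 · g 0 · a ^ j + ev n (λ m → f 0 R.* g (suc m)) * a ^ suc j
        ≈⟨ +-congˡ (trans (*-congʳ (ev-scale n (f 0) (g ∘ suc))) (•-*-assoc (f 0) _ _)) ⟩
      f 0 · g 0 · a ^ j + f 0 · (ev n (g ∘ suc) * a ^ suc j)
        ≈⟨ •-distribˡ (f 0) _ _ ⟨
      f 0 · (g 0 · a ^ j + ev n (g ∘ suc) * a ^ suc j)
        ≈⟨ •-cong R.refl (ev-suc-*-^ n j g) ⟨
      f 0 · (ev (suc n) g * a ^ j) ∎

    tail : ev n ((f ∘ suc) ⊛ g) * a ^ suc j ≈ ev n (f ∘ suc) * a * ev (suc n) g * a ^ j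
    tail = begin
      ev n ((f ∘ suc) ⊛ g) * a ^ suc j
        ≈⟨ ev-⊛-^ n (suc j) eq′ (f ∘ suc) g ⟩
      ev n (f ∘ suc) * ev n g * a ^ suc j
        ≈⟨ *-assoc _ _ _ ⟩
      ev n (f ∘ suc) * (ev n g * a ^ suc j)
        -- Lengthening the second factor to `suc n` terms is free here: its new term carries
        -- `a ^ (n + suc j)`, which is zero.
        ≈⟨ *-congˡ (ev-suc n (suc j) eq′ g) ⟨
      ev n (f ∘ suc) * (ev (suc n) g * (a * a ^ j))
        ≈⟨ *-congˡ (*-assoc _ a _) ⟨
      ev n (f ∘ suc) * (ev (suc n) g * a * a ^ j)
        ≈⟨ *-congˡ (*-congʳ (ev-comm (suc n) g)) ⟨
      ev n (f ∘ suc) * (a * ev (suc n) g * a ^ j)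
        ≈⟨ *-assoc _ _ _ ⟨
      ev n (f ∘ suc) * (a * ev (suc n) g) * a ^ j
        ≈⟨ *-congʳ (*-assoc _ _ _) ⟨
      ev n (f ∘ suc) * a * ev (suc n) g * a ^ j ∎

  ev-⊛ : ∀ n → a ^ n ≈ 0# → ∀ f g → ev n (f ⊛ g) ≈ ev n f * ev n g
  ev-⊛ n aⁿ≈0 f g = begin
    ev n (f ⊛ g)          ≈⟨ *-identityʳ _ ⟨
    ev n (f ⊛ g) * 1#     ≈⟨ ev-⊛-^ n 0 (trans (reflexive (≡.cong (a ^_) (ℕ.+-identityʳ n))) aⁿ≈0) f g ⟩
    ev n f * ev n g * 1#  ≈⟨ *-identityʳ _ ⟩
    ev n f * ev n g       ∎

  module _ (n : ℕ) (aⁿ≈0 : a ^ suc n ≈ 0#) where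

    private
      module Exp = SemiringExp Series.semiring
      module Sum = SemiringSum Series.semiring

    -- The length is a successor, so that the scheme reads the constant coefficient and the series 1
    -- is sent to `1#`.
    ev-^ : ∀ f k → ev (suc n) (f Exp.^ k) ≈ ev (suc n) f ^ k
    ev-^ f zero    = trans (ev-constant n R.1#) (•-identityˡ 1#)
    ev-^ f (suc k) = trans (ev-⊛ (suc n) aⁿ≈0 f (f Exp.^ k)) (*-congˡ (ev-^ f k))

    ev-sum : ∀ {k} (t : Fin k → Series) → ev (suc n) (Sum.sum t) ≈ sum (ev (suc n) ∘ t)
    ev-sum {zero}  t = ev-0 (suc n)
    ev-sum {suc k} t = trans (ev-+ (suc n) (t zero) (Sum.sum (t ∘ suc))) (+-congˡ (ev-sum (t ∘ suc)))

    ev-1+ƛ : ev (suc n) (Series.1# Series.+ ƛ) ≈ 1# + a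
    ev-1+ƛ = trans (ev-+ (suc n) Series.1# ƛ)
      (+-cong (trans (ev-constant n R.1#) (•-identityˡ 1#)) (ev-ƛ n aⁿ≈0))
      where
      ev-ƛ : ∀ n → a ^ suc n ≈ 0# → ev (suc n) ƛ ≈ a
      -- At length one only the zero constant coefficient is read; the value is still `a`, because
      -- `a ^ 1` is zero.
      ev-ƛ zero    a¹≈0 = trans (+-cong (zero-· 1#) (zeroˡ a))
        (trans (+-identityˡ 0#) (trans (sym a¹≈0) (*-identityʳ a)))
      ev-ƛ (suc n) _    = begin
        R.0# · 1# + ev (suc n) (ƛ ∘ suc) * a
          ≈⟨ +-cong (zero-· 1#) (*-congʳ (ev-cong (suc n) {ƛ ∘ suc} {constant R.1#}
               λ { zero _ → R.refl ; (suc m) _ → R.refl })) ⟩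
        0# + ev (suc n) (constant R.1#) * a
          ≈⟨ +-identityˡ _ ⟩
        ev (suc n) (constant R.1#) * a
          ≈⟨ *-congʳ (trans (ev-constant n R.1#) (•-identityˡ 1#)) ⟩
        1# * a
          ≈⟨ *-identityˡ a ⟩
        a ∎

-- Exponential and logarithm

module RationalMultiples where

  open SemiringMult (CommutativeRing.semiring ℚ.+-*-commutativeRing)
    using (×-comm-*; ×-assoc-*) renaming (_×_ to _×ₙ_)

  -- `ℚ./` normalises by a gcd, which is stuck on a variable `n`; among unnormalised fractions the
  -- equation is plain cross-multiplication.
  ℕ→ℚ-suc : ∀ n → ℤ.+ suc n ℚ./ 1 ≡ 1ℚ ℚ.+ (ℤ.+ n ℚ./ 1)
  ℕ→ℚ-suc n = ℚ.toℚᵘ-injective (begin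
    ℚ.toℚᵘ (ℤ.+ suc n ℚ./ 1)             ≈⟨ ℚ.toℚᵘ-fromℚᵘ (ℚᵘ.mkℚᵘ (ℤ.+ suc n) 0) ⟩
    ℚᵘ.mkℚᵘ (ℤ.+ suc n) 0                ≈⟨ ℚᵘ.*≡* (≡.cong (λ i → (ℤ.1ℤ ℤ.+ i) ℤ.* ℤ.1ℤ) (≡.sym (ℤ.*-identityʳ (ℤ.+ n)))) ⟩
    ℚᵘ.1ℚᵘ ℚᵘ.+ ℚᵘ.mkℚᵘ (ℤ.+ n) 0        ≈⟨ ℚᵘ.+-congʳ ℚᵘ.1ℚᵘ (ℚ.toℚᵘ-fromℚᵘ (ℚᵘ.mkℚᵘ (ℤ.+ n) 0)) ⟨
    ℚ.toℚᵘ 1ℚ ℚᵘ.+ ℚ.toℚᵘ (ℤ.+ n ℚ./ 1)  ≈⟨ ℚ.toℚᵘ-homo-+ 1ℚ (ℤ.+ n ℚ./ 1) ⟨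
    ℚ.toℚᵘ (1ℚ ℚ.+ (ℤ.+ n ℚ./ 1))        ∎)
    where open SetoidReasoning ℚᵘ.≃-setoid

  ×≡* : ∀ n x → n ×ₙ x ≡ (ℤ.+ n ℚ./ 1) ℚ.* x
  ×≡* zero    x = ≡.sym (ℚ.*-zeroˡ x)
  ×≡* (suc n) x = begin
    x ℚ.+ n ×ₙ x                      ≡⟨ ≡.cong₂ ℚ._+_ (≡.sym (ℚ.*-identityˡ x)) (×≡* n x) ⟩
    1ℚ ℚ.* x ℚ.+ (ℤ.+ n ℚ./ 1) ℚ.* x  ≡⟨ ℚ.*-distribʳ-+ x 1ℚ (ℤ.+ n ℚ./ 1) ⟨
    (1ℚ ℚ.+ (ℤ.+ n ℚ./ 1)) ℚ.* x      ≡⟨ ≡.cong (ℚ._* x) (ℕ→ℚ-suc n) ⟨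
    (ℤ.+ suc n ℚ./ 1) ℚ.* x           ∎
    where open ≡.≡-Reasoning

  -- Serves both coefficient recurrences: with `d` = (k + 1)! and `m` = k! for the exponential, and
  -- with `d` = k + 1 and `m` = 1 for the logarithm.
  ×-/ : ∀ i k m d .{{_ : ℕ.NonZero m}} .{{_ : ℕ.NonZero d}} → d ≡ suc k ℕ.* m →
        suc k ×ₙ (i ℚ./ d) ≡ i ℚ./ m
  ×-/ i k m@(suc _) d@(suc _) d≡ = ≡.trans (×≡* (suc k) (i ℚ./ d)) (ℚ.toℚᵘ-injective (begin
    ℚ.toℚᵘ ((ℤ.+ suc k ℚ./ 1) ℚ.* (i ℚ./ d))
      ≈⟨ ℚ.toℚᵘ-homo-* (ℤ.+ suc k ℚ./ 1) (i ℚ./ d) ⟩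
    ℚ.toℚᵘ (ℤ.+ suc k ℚ./ 1) ℚᵘ.* ℚ.toℚᵘ (i ℚ./ d)
      ≈⟨ ℚᵘ.*-cong (ℚ.toℚᵘ-fromℚᵘ (ℤ.+ suc k ℚᵘ./ 1)) (ℚ.toℚᵘ-fromℚᵘ (i ℚᵘ./ d)) ⟩
    (ℤ.+ suc k ℚᵘ./ 1) ℚᵘ.* (i ℚᵘ./ d)
      ≈⟨ ℚᵘ.*≡* cross ⟩
    i ℚᵘ./ m
      ≈⟨ ℚ.toℚᵘ-fromℚᵘ (i ℚᵘ./ m) ⟨
    ℚ.toℚᵘ (i ℚ./ m) ∎))
    where
    open SetoidReasoning ℚᵘ.≃-setoid
    cross : ℤ.+ suc k ℤ.* i ℤ.* ℤ.+ m ≡ i ℤ.* (ℤ.1ℤ ℤ.* ℤ.+ d)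
    cross = R.begin
      ℤ.+ suc k ℤ.* i ℤ.* ℤ.+ m    R.≡⟨ ≡.cong (ℤ._* ℤ.+ m) (ℤ.*-comm (ℤ.+ suc k) i) ⟩
      i ℤ.* ℤ.+ suc k ℤ.* ℤ.+ m    R.≡⟨ ℤ.*-assoc i (ℤ.+ suc k) (ℤ.+ m) ⟩
      i ℤ.* (ℤ.+ suc k ℤ.* ℤ.+ m)  R.≡⟨ ≡.cong (i ℤ.*_) (ℤ.pos-* (suc k) m) ⟨
      i ℤ.* ℤ.+ (suc k ℕ.* m)      R.≡⟨ ≡.cong (λ j → i ℤ.* ℤ.+ j) d≡ ⟨
      i ℤ.* ℤ.+ d                  R.≡⟨ ≡.cong (i ℤ.*_) (ℤ.*-identityˡ (ℤ.+ d)) ⟨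
      i ℤ.* (ℤ.1ℤ ℤ.* ℤ.+ d)       R.∎
      where module R = ≡.≡-Reasoning

  -- This division by k + 1, available in ℚ, is what lets a recurrence for (k + 1) f(k + 1)
  -- determine the next coefficient.
  ×-cancelˡ : ∀ k {x y} → suc k ×ₙ x ≡ suc k ×ₙ y → x ≡ y
  ×-cancelˡ k {x} {y} eq = ≡.trans (scaled x) (≡.trans (≡.cong (ℤ.1ℤ ℚ./ suc k ℚ.*_) eq) (≡.sym (scaled y)))
    where
    open ≡.≡-Reasoning
    scaled : ∀ z → z ≡ (ℤ.1ℤ ℚ./ suc k) ℚ.* (suc k ×ₙ z)
    scaled z = begin
      z                                  ≡⟨ ℚ.*-identityˡ z ⟨
      1ℚ ℚ.* z                           ≡⟨ ≡.cong (ℚ._* z) (×-/ ℤ.1ℤ k 1 (suc k) (≡.sym (ℕ.*-identityʳ (suc k)))) ⟨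
      (suc k ×ₙ (ℤ.1ℤ ℚ./ suc k)) ℚ.* z  ≡⟨ ×-assoc-* (suc k) (ℤ.1ℤ ℚ./ suc k) z ⟩
      suc k ×ₙ ((ℤ.1ℤ ℚ./ suc k) ℚ.* z)  ≡⟨ ×-comm-* (suc k) (ℤ.1ℤ ℚ./ suc k) z ⟨
      (ℤ.1ℤ ℚ./ suc k) ℚ.* (suc k ×ₙ z)  ∎

  -1^suc+-1^ : ∀ n → (ℤ.-1ℤ ℤ.^ suc n) ℚ./ 1 ℚ.+ (ℤ.-1ℤ ℤ.^ n) ℚ./ 1 ≡ 0ℚ
  -1^suc+-1^ zero    = ≡.refl
  -1^suc+-1^ (suc n) = ≡.trans (ℚ.+-comm (ℤ.-1ℤ ℤ.^ suc (suc n) ℚ./ 1) (ℤ.-1ℤ ℤ.^ suc n ℚ./ 1))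
    (≡.trans (≡.cong (λ i → ℤ.-1ℤ ℤ.^ suc n ℚ./ 1 ℚ.+ i ℚ./ 1) -1*-1*) (-1^suc+-1^ n))
    where
    -1*-1* : ℤ.-1ℤ ℤ.^ suc (suc n) ≡ ℤ.-1ℤ ℤ.^ n
    -1*-1* = ≡.trans (≡.sym (ℤ.*-assoc ℤ.-1ℤ ℤ.-1ℤ (ℤ.-1ℤ ℤ.^ n))) (ℤ.*-identityˡ _)

-- The identity exp(n ln(1 + x)) = (1 + x)ⁿ up to a given degree

module LogExp where

  open SemiringMult (CommutativeRing.semiring ℚ.+-*-commutativeRing)
    using (×-assoc-*) renaming (_×_ to _×ₙ_)
  open SemiringExp (CommutativeRing.semiring ℚ.+-*-commutativeRing) using (_^_)
  open SeriesRing ℚ.+-*-commutativeRing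
  open SeriesCoefficients ℚ.+-*-commutativeRing
  open PowerSeries ℚ.+-*-rawRing using (constant; ƛ)
  open RationalMultiples

  private
    module Mult = SemiringMult Series.semiring
    module Exp = SemiringExp Series.semiring
    module ΣQ = SemiringSum (CommutativeRing.semiring ℚ.+-*-commutativeRing)
    module D = Derivation seriesRing θ-isDerivation

  logSeries : Series
  logSeries zero    = 0ℚ
  logSeries (suc n) = (ℤ.-1ℤ ℤ.^ n) ℚ./ suc n

  expCoefficient : ℚ → ℕ → ℚ
  expCoefficient t n = (ℤ.1ℤ ℚ./ (n !)) {{n ℕ.!≢0}} ℚ.* t ^ n

  expCoefficient-suc : ∀ t k → suc k ×ₙ expCoefficient t (suc k) ≡ t ℚ.* expCoefficient t k
  expCoefficient-suc t k = begin
    suc k ×ₙ (1/[1+k]! ℚ.* (t ℚ.* t ^ k))  ≡⟨ ×-assoc-* (suc k) 1/[1+k]! (t ℚ.* t ^ k) ⟨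
    (suc k ×ₙ 1/[1+k]!) ℚ.* (t ℚ.* t ^ k)  ≡⟨ ≡.cong (ℚ._* (t ℚ.* t ^ k)) 1/k!≡ ⟩
    1/k! ℚ.* (t ℚ.* t ^ k)                 ≡⟨ x∙yz≈y∙xz 1/k! t (t ^ k) ⟩
    t ℚ.* (1/k! ℚ.* t ^ k)                 ∎
    where
    open ≡.≡-Reasoning
    open CommutativeSemigroupProperties
      (CommutativeMonoid.commutativeSemigroup ℚ.*-1-commutativeMonoid) using (x∙yz≈y∙xz)
    1/[1+k]! = (ℤ.1ℤ ℚ./ (suc k !)) {{suc k ℕ.!≢0}}
    1/k!     = (ℤ.1ℤ ℚ./ (k !)) {{k ℕ.!≢0}}
    1/k!≡ : suc k ×ₙ 1/[1+k]! ≡ 1/k!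
    1/k!≡ = ×-/ ℤ.1ℤ k (k !) (suc k !) {{k ℕ.!≢0}} {{suc k ℕ.!≢0}} ≡.refl

  expTerm : ℚ → ℕ → Series
  expTerm t k = constant (expCoefficient t k) Series.* logSeries Exp.^ k

  -- This is θ ln(1 + x) = x/(1 + x) with the denominator cleared. θ removes the denominators of the
  -- logarithm and leaves alternating signs; multiplying by 1 + x adds neighbouring coefficients,
  -- which cancel.
  1+ƛ-⊛-θlog : 1+ƛ Series.* θ logSeries Series.≈ ƛ
  1+ƛ-⊛-θlog zero          = 1+ƛ-⊛-zero (θ logSeries)
  1+ƛ-⊛-θlog (suc zero)    = 1+ƛ-⊛-suc (θ logSeries) 0
  1+ƛ-⊛-θlog (suc (suc n)) = ≡.trans (1+ƛ-⊛-suc (θ logSeries) (suc n))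
    (≡.trans (≡.cong₂ ℚ._+_ (θlog (suc n)) (θlog n)) (-1^suc+-1^ n))
    where
    θlog : ∀ n → θ logSeries (suc n) ≡ (ℤ.-1ℤ ℤ.^ n) ℚ./ 1
    θlog n = ×-/ (ℤ.-1ℤ ℤ.^ n) n 1 (suc n) (≡.sym (ℕ.*-identityʳ (suc n)))

  -- The recurrence is the equation (1 + x) θf = t x f in coefficients.
  binomial-unique : ∀ t s (f g : Series) → f 0 ≡ g 0 →
    (∀ m → m ℕ.< s → suc m ×ₙ f (suc m) ℚ.+ m ×ₙ f m ≡ t ℚ.* f m) →
    (∀ m → m ℕ.< s → suc m ×ₙ g (suc m) ℚ.+ m ×ₙ g m ≡ t ℚ.* g m) →
    ∀ m → m ℕ.< suc s → f m ≡ g m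
  binomial-unique t s f g f₀≡g₀ rec-f rec-g zero    _         = f₀≡g₀
  binomial-unique t s f g f₀≡g₀ rec-f rec-g (suc m) (s≤s m<s) =
    ×-cancelˡ m (∙-cancelʳ (m ×ₙ f m) (suc m ×ₙ f (suc m)) (suc m ×ₙ g (suc m)) (begin
      suc m ×ₙ f (suc m) ℚ.+ m ×ₙ f m  ≡⟨ rec-f m m<s ⟩
      t ℚ.* f m                        ≡⟨ ≡.cong (t ℚ.*_) f≡g ⟩
      t ℚ.* g m                        ≡⟨ rec-g m m<s ⟨
      suc m ×ₙ g (suc m) ℚ.+ m ×ₙ g m  ≡⟨ ≡.cong (λ q → suc m ×ₙ g (suc m) ℚ.+ m ×ₙ q) f≡g ⟨
      suc m ×ₙ g (suc m) ℚ.+ m ×ₙ f m  ∎))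
    where
    open ≡.≡-Reasoning
    open GroupProperties ℚ.+-0-group using (∙-cancelʳ)
    f≡g = binomial-unique t s f g f₀≡g₀ rec-f rec-g m (ℕ.<-trans m<s (ℕ.n<1+n s))

  module _ (n s : ℕ) where

    private
      t = ℤ.+ n ℚ./ 1

    powerSeries : Series
    powerSeries = 1+ƛ Exp.^ n

    expSeries : ℕ → Series
    expSeries = D.partialSum (constant ∘ expCoefficient t) logSeries

    1+ƛ-⊛-θ-power : 1+ƛ Series.* θ powerSeries Series.≈ n Mult.× (ƛ Series.* powerSeries)
    1+ƛ-⊛-θ-power = D.*-θ-^ {1+ƛ} {ƛ} θ-1+ƛ n

    powerSeries-recurrence : ∀ m → suc m ×ₙ powerSeries (suc m) ℚ.+ m ×ₙ powerSeries m ≡ t ℚ.* powerSeries m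
    powerSeries-recurrence m = begin
      θ powerSeries (suc m) ℚ.+ θ powerSeries m  ≡⟨ 1+ƛ-⊛-suc (θ powerSeries) m ⟨
      (1+ƛ ⊛ θ powerSeries) (suc m)              ≡⟨ 1+ƛ-⊛-θ-power (suc m) ⟩
      (n Mult.× (ƛ ⊛ powerSeries)) (suc m)       ≡⟨ ×-coefficient n (ƛ ⊛ powerSeries) (suc m) ⟩
      n ×ₙ (ƛ ⊛ powerSeries) (suc m)             ≡⟨ ≡.cong (n ×ₙ_) (ƛ-⊛ powerSeries m) ⟩
      n ×ₙ powerSeries m                         ≡⟨ ×≡* n (powerSeries m) ⟩
      t ℚ.* powerSeries m                        ∎
      where open ≡.≡-Reasoning

    constant-expCoefficient-suc : ∀ k →
      suc k Mult.× constant (expCoefficient t (suc k)) Series.≈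
      constant t Series.* constant (expCoefficient t k)
    constant-expCoefficient-suc k m = ≡.trans
      (×-coefficient (suc k) (constant (expCoefficient t (suc k))) m)
      (≡.trans (constant-coefficient m) (≡.sym (constant-⊛ t (constant (expCoefficient t k)) m)))
      where
      constant-coefficient : ∀ m → suc k ×ₙ constant (expCoefficient t (suc k)) m ≡
                                   t ℚ.* constant (expCoefficient t k) m
      constant-coefficient zero    = expCoefficient-suc t k
      constant-coefficient (suc m) = ≡.trans (×≡* (suc k) 0ℚ)
        (≡.trans (ℚ.*-zeroʳ (ℤ.+ suc k ℚ./ 1)) (≡.sym (ℚ.*-zeroʳ t)))

    1+ƛ-⊛-θ-exp : 1+ƛ Series.* θ (expSeries (suc s)) Series.≈
                  constant t Series.* (ƛ Series.* expSeries s)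
    1+ƛ-⊛-θ-exp = D.*-θ-exp (constant ∘ expCoefficient t) (constant t)
      (θ-constant ∘ expCoefficient t) constant-expCoefficient-suc
      {1+ƛ} {logSeries} {ƛ} 1+ƛ-⊛-θlog s

    -- The last summand of the longer sum has order s.
    expSeries-init : ∀ m → m ℕ.< s → expSeries (suc s) m ≡ expSeries s m
    expSeries-init m m<s = begin
      expSeries (suc s) m
        ≡⟨ sum-coefficient {suc s} (λ k → expTerm t (toℕ k)) m ⟩
      ΣQ.sum {suc s} (λ k → expTerm t (toℕ k) m)
        ≡⟨ ΣQ.sum-init-last {s} (λ k → expTerm t (toℕ k) m) ⟩
      ΣQ.sum {s} (λ k → expTerm t (toℕ (inject₁ k)) m) ℚ.+ expTerm t (toℕ (fromℕ s)) m
        ≡⟨ ≡.cong₂ ℚ._+_ (ΣQ.sum-cong-≗ {s} (λ k → ≡.cong (λ j → expTerm t j m) (Fin.toℕ-inject₁ k)))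
             (≡.trans (≡.cong (λ j → expTerm t j m) (Fin.toℕ-fromℕ s)) last≡0) ⟩
      ΣQ.sum {s} (λ k → expTerm t (toℕ k) m) ℚ.+ 0ℚ
        ≡⟨ ℚ.+-identityʳ _ ⟩
      ΣQ.sum {s} (λ k → expTerm t (toℕ k) m)
        ≡⟨ sum-coefficient {s} (λ k → expTerm t (toℕ k)) m ⟨
      expSeries s m ∎
      where
      open ≡.≡-Reasoning
      last≡0 : expTerm t s m ≡ 0ℚ
      last≡0 = ⊛-order (logSeries Exp.^ s) (^-order {logSeries} ≡.refl s)
        (constant (expCoefficient t s)) m m<s

    -- The differential equation relates the truncations with `suc s` and `s` summands. They
    -- coincide only below degree `s`, whence the bound on `m`.
    expSeries-recurrence : ∀ m → m ℕ.< s →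
      suc m ×ₙ expSeries (suc s) (suc m) ℚ.+ m ×ₙ expSeries (suc s) m ≡ t ℚ.* expSeries (suc s) m
    expSeries-recurrence m m<s = begin
      θ (expSeries (suc s)) (suc m) ℚ.+ θ (expSeries (suc s)) m
        ≡⟨ 1+ƛ-⊛-suc (θ (expSeries (suc s))) m ⟨
      (1+ƛ ⊛ θ (expSeries (suc s))) (suc m)
        ≡⟨ 1+ƛ-⊛-θ-exp (suc m) ⟩
      (constant t ⊛ (ƛ ⊛ expSeries s)) (suc m)
        ≡⟨ constant-⊛ t (ƛ ⊛ expSeries s) (suc m) ⟩
      t ℚ.* (ƛ ⊛ expSeries s) (suc m)
        ≡⟨ ≡.cong (t ℚ.*_) (ƛ-⊛ (expSeries s) m) ⟩
      t ℚ.* expSeries s m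
        ≡⟨ ≡.cong (t ℚ.*_) (expSeries-init m m<s) ⟨
      t ℚ.* expSeries (suc s) m ∎
      where open ≡.≡-Reasoning

    expSeries-zero : expSeries (suc s) 0 ≡ 1ℚ
    expSeries-zero = begin
      expSeries (suc s) 0
        ≡⟨ sum-coefficient {suc s} (λ k → expTerm t (toℕ k)) 0 ⟩
      expTerm t 0 0 ℚ.+ ΣQ.sum {s} (λ k → expTerm t (suc (toℕ k)) 0)
        -- `expTerm t 0 0` computes to `1ℚ`; every later term contains a power of the logarithm,
        -- which has no constant term.
        ≡⟨ ≡.cong (1ℚ ℚ.+_) (ΣQ.sum-cong-≗ {s} {_} {λ _ → 0ℚ} (λ k → term≡0 (toℕ k))) ⟩
      1ℚ ℚ.+ ΣQ.sum {s} (λ _ → 0ℚ)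
        ≡⟨ ≡.cong (1ℚ ℚ.+_) (ΣQ.sum-replicate-zero s) ⟩
      1ℚ ∎
      where
      open ≡.≡-Reasoning
      term≡0 : ∀ k → expTerm t (suc k) 0 ≡ 0ℚ
      term≡0 k = ⊛-order {suc k} (logSeries Exp.^ suc k) (^-order {logSeries} ≡.refl (suc k))
        (constant (expCoefficient t (suc k))) 0 (s≤s z≤n)

    exp-log : ∀ m → m ℕ.< suc s → expSeries (suc s) m ≡ powerSeries m
    exp-log = binomial-unique t s (expSeries (suc s)) powerSeries
      (≡.trans expSeries-zero (≡.sym (1+ƛ-^-zero n)))
      expSeries-recurrence (λ m _ → powerSeries-recurrence m)

-- Exponential and logarithm of a nilpotent element

module NilpotentExpLog (S : Ring c ℓ)
  {_•_ : ℚ → Ring.Carrier S → Ring.Carrier S}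
  (isAlgebra : IsAssociativeAlgebra ℚ.+-*-commutativeRing S _•_)
  (a : Ring.Carrier S) (s : ℕ)
  where

  open Ring S hiding (zero)
  open SemiringExp semiring using (_^_; ^-congˡ)
  open SemiringSum semiring using (sum; sum-cong-≋)
  open Evaluation ℚ.+-*-commutativeRing S isAlgebra a
  open AlgebraProperties ℚ.+-*-commutativeRing S isAlgebra
  open IsAssociativeAlgebra isAlgebra
  open SetoidReasoning setoid
  open SeriesRing ℚ.+-*-commutativeRing
  open SeriesCoefficients ℚ.+-*-commutativeRing using (1+ƛ)
  open PowerSeries ℚ.+-*-rawRing using (constant)
  open LogExp

  -- The truncations of `log` and `exp`, at `s` and `suc s` summands, copy those in `Φ` and `Θ`; for
  -- `a` = `A` and `s` = `size` they agree with them definitionally.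
  log : Carrier
  log = sum {s} (λ i → logSeries (suc (toℕ i)) · a ^ suc (toℕ i))

  exp : ℚ → Carrier → Carrier
  exp t x = sum {suc s} (λ k → expCoefficient t (toℕ k) · x ^ toℕ k)

  module _ (aˢ⁺¹≈0 : a ^ suc s ≈ 0#) (n : ℕ) where

    private
      t = ℤ.+ n ℚ./ 1
      module Exp = SemiringExp Series.semiring

    -- Evaluation reads `suc s` coefficients, of which the constant one is zero; the other `s` are
    -- the summands of `log`.
    ev-log : ev (suc s) logSeries ≈ log
    ev-log = trans (ev≈sum (suc s) logSeries) (trans (+-congʳ (zero-· 1#)) (+-identityˡ log))

    ev-exp : ev (suc s) (expSeries n s (suc s)) ≈ exp t log
    ev-exp = begin
      ev (suc s) (expSeries n s (suc s))
        ≈⟨ ev-sum s aˢ⁺¹≈0 {suc s} (λ k → expTerm t (toℕ k)) ⟩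
      sum {suc s} (λ k → ev (suc s) (expTerm t (toℕ k)))
        ≈⟨ sum-cong-≋ {suc s} (λ k → ev-term (toℕ k)) ⟩
      exp t log ∎
      where
      ev-term : ∀ k → ev (suc s) (expTerm t k) ≈ expCoefficient t k · log ^ k
      ev-term k = begin
        ev (suc s) (expTerm t k)
          ≈⟨ ev-cong (suc s) {expTerm t k} {λ m → expCoefficient t k ℚ.* (logSeries Exp.^ k) m}
               (λ m _ → constant-⊛ (expCoefficient t k) (logSeries Exp.^ k) m) ⟩
        ev (suc s) (λ m → expCoefficient t k ℚ.* (logSeries Exp.^ k) m)
          ≈⟨ ev-scale (suc s) (expCoefficient t k) (logSeries Exp.^ k) ⟩
        expCoefficient t k · ev (suc s) (logSeries Exp.^ k)
          ≈⟨ •-cong ≡.refl (trans (ev-^ s aˢ⁺¹≈0 logSeries k) (^-congˡ k ev-log)) ⟩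
        expCoefficient t k · log ^ k ∎

    exp-log≈power : exp t log ≈ (1# + a) ^ n
    exp-log≈power = begin
      exp t log                           ≈⟨ ev-exp ⟨
      ev (suc s) (expSeries n s (suc s))  ≈⟨ ev-cong (suc s) (exp-log n s) ⟩
      ev (suc s) (1+ƛ Exp.^ n)            ≈⟨ ev-^ s aˢ⁺¹≈0 1+ƛ n ⟩
      ev (suc s) 1+ƛ ^ n                  ≈⟨ ^-congˡ n (ev-1+ƛ s aˢ⁺¹≈0) ⟩
      (1# + a) ^ n                        ∎

-- Resolvents

module Resolvent (R : CommutativeRing c ℓ) (S : Ring c′ ℓ′)
  {_•_ : CommutativeRing.Carrier R → Ring.Carrier S → Ring.Carrier S}
  (isAlgebra : IsAssociativeAlgebra R S _•_)
  where

  private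
    module R = CommutativeRing R

  open Ring S hiding (zero)
  open IsAssociativeAlgebra isAlgebra
  open AlgebraProperties R S isAlgebra
  open RingProperties S using (x[y-z]≈xy-xz; [y-z]x≈yx-zx)
  open GroupProperties +-group using (inverseʳ-unique)
  open SetoidReasoning setoid

  x+y-y≈x : ∀ x y → (x + y) - y ≈ x
  x+y-y≈x x y = trans (+-assoc x y (- y)) (trans (+-congˡ (-‿inverseʳ y)) (+-identityʳ x))

  -- The hypothesis is the fixed-point equation of a geometric series in `r · b`. It differs from
  -- the one in `inverseʳ` because `e` and `b` are not assumed to commute.
  inverseˡ : ∀ {r b e} → e ≈ 1# + r · (e * b) → e * (1# - r · b) ≈ 1#
  inverseˡ {r} {b} {e} e≈ = begin
    e * (1# - r · b)                ≈⟨ x[y-z]≈xy-xz e 1# (r · b) ⟩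
    e * 1# - e * r · b              ≈⟨ +-cong (*-identityʳ e) (-‿cong (•-*-comm r e b)) ⟩
    e - r · (e * b)                 ≈⟨ +-congʳ e≈ ⟩
    1# + r · (e * b) - r · (e * b)  ≈⟨ x+y-y≈x 1# _ ⟩
    1#                              ∎

  inverseʳ : ∀ {r b e} → e ≈ 1# + r · (b * e) → (1# - r · b) * e ≈ 1#
  inverseʳ {r} {b} {e} e≈ = begin
    (1# - r · b) * e                ≈⟨ [y-z]x≈yx-zx e 1# (r · b) ⟩
    1# * e - r · b * e              ≈⟨ +-cong (*-identityˡ e) (-‿cong (•-*-assoc r b e)) ⟩
    e - r · (b * e)                 ≈⟨ +-congʳ e≈ ⟩
    1# + r · (b * e) - r · (b * e)  ≈⟨ x+y-y≈x 1# _ ⟩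
    1#                              ∎

  neg-· : ∀ r x → (R.- r) · x ≈ - (r · x)
  neg-· r x = inverseʳ-unique _ _ (begin
    r · x + (R.- r) · x  ≈⟨ •-distribʳ x r (R.- r) ⟨
    (r R.- r) · x        ≈⟨ •-cong (R.-‿inverseʳ r) refl ⟩
    R.0# · x             ≈⟨ zero-· x ⟩
    0#                   ∎)

  ·-neg : ∀ r x → r · (- x) ≈ - (r · x)
  ·-neg r x = inverseʳ-unique _ _ (begin
    r · x + r · (- x)  ≈⟨ •-distribˡ r x (- x) ⟨
    r · (x - x)        ≈⟨ •-cong R.refl (-‿inverseʳ x) ⟩
    r · 0#             ≈⟨ ·-zero r ⟩
    0#                 ∎)

  -- `v` stands for 1/(1 - r), so `r R.* v` is r/(1 - r).
  module Rescaling {r v : R.Carrier} (v[1-r]≈1 : v R.* (R.1# R.- r) R.≈ R.1#) where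

    rescale : ∀ {b b̃} → b̃ ≈ 1# + b → (R.1# R.- r) · (1# - (r R.* v) · b) ≈ 1# - r · b̃
    rescale {b} {b̃} b̃≈1+b = begin
      (R.1# R.- r) · (1# - (r R.* v) · b)
        ≈⟨ •-distribˡ _ 1# _ ⟩
      (R.1# R.- r) · 1# + (R.1# R.- r) · (- ((r R.* v) · b))
        ≈⟨ +-cong (trans (•-distribʳ 1# _ _) (+-cong (•-identityˡ 1#) (neg-· r 1#)))
             (trans (·-neg _ _) (-‿cong (trans (sym (•-assoc _ _ b)) (•-cong cancel refl)))) ⟩
      1# - r · 1# - r · b
        ≈⟨ +-assoc _ _ _ ⟩
      1# + (- (r · 1#) - r · b)
        ≈⟨ +-congˡ (⁻¹-∙-comm _ _) ⟩
      1# - (r · 1# + r · b)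
        ≈⟨ +-congˡ (-‿cong (trans (•-cong R.refl b̃≈1+b) (•-distribˡ r 1# b))) ⟨
      1# - r · b̃ ∎
      where
      open AbelianGroupProperties +-abelianGroup using (⁻¹-∙-comm)
      cancel : (R.1# R.- r) R.* (r R.* v) R.≈ r
      cancel = R.trans (R.*-comm _ _) (R.trans (R.*-assoc r v _)
        (R.trans (R.*-congˡ v[1-r]≈1) (R.*-identityʳ r)))

    -- The scalar 1 - r is central, so it can leave `e` and join the other factor, where `rescale`
    -- turns the product into `1# - r · b̃`.
    rescaled-inverseˡ : ∀ {b b̃ e} → b̃ ≈ 1# + b → e * (1# - r · b̃) ≈ 1# →
                        (R.1# R.- r) · e * (1# - (r R.* v) · b) ≈ 1#
    rescaled-inverseˡ {b} {b̃} {e} b̃≈1+b eq = begin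
      (R.1# R.- r) · e * (1# - (r R.* v) · b)    ≈⟨ •-*-assoc _ e _ ⟩
      (R.1# R.- r) · (e * (1# - (r R.* v) · b))  ≈⟨ •-*-comm _ e _ ⟨
      e * (R.1# R.- r) · (1# - (r R.* v) · b)    ≈⟨ *-congˡ (rescale b̃≈1+b) ⟩
      e * (1# - r · b̃)                          ≈⟨ eq ⟩
      1#                                         ∎

    rescaled-inverseʳ : ∀ {b b̃ e} → b̃ ≈ 1# + b → (1# - r · b̃) * e ≈ 1# →
                        (1# - (r R.* v) · b) * (R.1# R.- r) · e ≈ 1#
    rescaled-inverseʳ {b} {b̃} {e} b̃≈1+b eq = begin
      (1# - (r R.* v) · b) * (R.1# R.- r) · e    ≈⟨ •-*-comm _ _ e ⟩
      (R.1# R.- r) · ((1# - (r R.* v) · b) * e)  ≈⟨ •-*-assoc _ _ e ⟨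
      (R.1# R.- r) · (1# - (r R.* v) · b) * e    ≈⟨ *-congʳ (rescale b̃≈1+b) ⟩
      (1# - r · b̃) * e                          ≈⟨ eq ⟩
      1#                                         ∎

    ·-cancel : ∀ e → e ≈ v · (R.1# R.- r) · e
    ·-cancel e = sym (trans (sym (•-assoc v _ e)) (trans (•-cong v[1-r]≈1 refl) (•-identityˡ e)))

-- The scalar series 1/(1 - λ)

module GeometricSeries (R : CommutativeRing c ℓ) where

  open CommutativeRing R hiding (zero)
  open SeriesRing R
  open PowerSeries rawRing using (ƛ)
  open RingProperties Series.ring using ([y-z]x≈yx-zx)

  1/[1-ƛ] : Series
  1/[1-ƛ] _ = 1#

  1/[1-ƛ]-inverseʳ : (Series.1# Series.- ƛ) Series.* 1/[1-ƛ] Series.≈ Series.1#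
  1/[1-ƛ]-inverseʳ n = trans ([y-z]x≈yx-zx 1/[1-ƛ] Series.1# ƛ n)
    (trans (+-congʳ (⊛-identityˡ 1/[1-ƛ] n)) (difference n))
    where
    difference : ∀ n → 1# - (ƛ ⊛ 1/[1-ƛ]) n ≈ Series.1# n
    difference zero    = trans (+-congˡ (trans (-‿cong (ƛ-⊛-zero 1/[1-ƛ])) -0#≈0#)) (+-identityʳ 1#)
      where open RingProperties ring using (-0#≈0#)
    difference (suc n) = trans (+-congˡ (-‿cong (ƛ-⊛ 1/[1-ƛ] n))) (-‿inverseʳ 1#)

  1/[1-ƛ]-inverseˡ : 1/[1-ƛ] Series.* (Series.1# Series.- ƛ) Series.≈ Series.1#
  1/[1-ƛ]-inverseˡ n = trans (⊛-comm 1/[1-ƛ] (Series.1# Series.- ƛ) n) (1/[1-ƛ]-inverseʳ n)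

-- The generating function of a labeled poset as a resolvent

module PosetResolvent (L : LabeledPoset) where

  open LabeledPoset L using (size)
  open GeneratingFunction L
  open PosetMatrices L using (ideals; Θ; Degree-^; Degree-A; Degree⇒0)
  open MatrixRing ℚ.+-*-commutativeRing (proj₂ ideals) using (matrices; isAssociativeAlgebra)
  open SeriesRing ℚ.+-*-commutativeRing
  open SeriesCoefficients ℚ.+-*-commutativeRing using (sum-coefficient)
  open Inverse (proj₂ ideals) using (to; from)
  open Evaluation ℚ.+-*-commutativeRing matrices isAssociativeAlgebra Ã using (^-comm)
  open ≡.≡-Reasoning

  module Mat = Ring matrices
  module Mat[[x]] = MatrixRing seriesRing (proj₂ ideals)
  module SMat = Ring Mat[[x]].matrices

  open SemiringExp Mat.semiring using (_^_)
  open SemiringSum (CommutativeRing.semiring ℚ.+-*-commutativeRing) using (sum-cong-≗)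
  open Resolvent seriesRing Mat[[x]].matrices Mat[[x]].isAssociativeAlgebra
    using (inverseˡ; inverseʳ)

  -- Each factor `A` forces the ideal to grow by at least one element, and an ideal has at most
  -- `size` of them, so `A ^ suc size` vanishes.
  Θ≈Ã^ : ∀ n → Θ (ℤ.+ n ℚ./ 1) Mat.≈ Ã ^ n
  Θ≈Ã^ = NilpotentExpLog.exp-log≈power matrices isAssociativeAlgebra A size
    (Degree⇒0 (ℕ.n<1+n size) (Degree-^ Degree-A (suc size)))

  -- A lifted matrix has constant entries, so multiplying by it acts on each power of λ separately.
  lift-* : ∀ M X I J n → (lift M SMat.* X) I J n ≡ (M Mat.* (λ K K′ → X K K′ n)) I J
  lift-* M X I J n = ≡.trans (sum-coefficient (λ k → lift M I (to k) Series.* X (to k) J) n)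
    (sum-cong-≗ (λ k → constant-⊛ (M I (to k)) (X (to k) J) n))

  *-lift : ∀ M X I J n → (X SMat.* lift M) I J n ≡ ((λ K K′ → X K K′ n) Mat.* M) I J
  *-lift M X I J n = ≡.trans (sum-coefficient (λ k → X I (to k) Series.* lift M (to k) J) n)
    (sum-cong-≗ (λ k → begin
      (X I (to k) ⊛ lift M (to k) J) n  ≡⟨ ⊛-comm (X I (to k)) (lift M (to k) J) n ⟩
      (lift M (to k) J ⊛ X I (to k)) n  ≡⟨ constant-⊛ (M (to k) J) (X I (to k)) n ⟩
      M (to k) J ℚ.* X I (to k) n       ≡⟨ ℚ.*-comm (M (to k) J) (X I (to k) n) ⟩
      X I (to k) n ℚ.* M (to k) J       ∎))

  𝐈-coefficient : ∀ I J n → 𝐈 I J n ≡ constant (Mat.1# I J) n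
  𝐈-coefficient I J n with from I Fin.≟ from J
  𝐈-coefficient I J n       | yes _ = ≡.refl
  𝐈-coefficient I J zero    | no  _ = ≡.refl
  𝐈-coefficient I J (suc n) | no  _ = ≡.refl

  lift-Ã : lift Ã ≈ 𝐈 SMat.+ lift A
  lift-Ã I J zero    = ≡.cong (ℚ._+ A I J) (≡.sym (𝐈-coefficient I J 0))
  lift-Ã I J (suc n) = ≡.cong (ℚ._+ 0ℚ) (≡.sym (𝐈-coefficient I J (suc n)))

  -- The fixed-point equation read off coefficientwise: multiplying by λ shifts `X` up one place,
  -- and the vacated constant coefficient is Θ(0) = Ã⁰. It is applied to both products of `E` with
  -- `lift Ã`.
  unfold-E : ∀ X → (∀ I J n → X I J n ≡ E I J (suc n)) → E ≈ 𝐈 SMat.+ ƛ • X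
  unfold-E X X≡ I J zero    = begin
    E I J 0                    ≡⟨ Θ≈Ã^ 0 I J ⟩
    Mat.1# I J                 ≡⟨ ℚ.+-identityʳ (Mat.1# I J) ⟨
    Mat.1# I J ℚ.+ 0ℚ          ≡⟨ ≡.cong₂ ℚ._+_ (𝐈-coefficient I J 0) (ƛ-⊛-zero (X I J)) ⟨
    𝐈 I J 0 ℚ.+ (ƛ ⊛ X I J) 0  ∎
  unfold-E X X≡ I J (suc n) = begin
    E I J (suc n)                          ≡⟨ X≡ I J n ⟨
    X I J n                                ≡⟨ ℚ.+-identityˡ (X I J n) ⟨
    0ℚ ℚ.+ X I J n                         ≡⟨ ≡.cong₂ ℚ._+_ (𝐈-coefficient I J (suc n)) (ƛ-⊛ (X I J) n) ⟨
    𝐈 I J (suc n) ℚ.+ (ƛ ⊛ X I J) (suc n)  ∎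

  E-inverseˡ : E SMat.* (𝐈 - ƛ • lift Ã) ≈ 𝐈
  E-inverseˡ = inverseˡ {ƛ} {lift Ã} {E} (unfold-E (E SMat.* lift Ã) λ I J n → begin
    (E SMat.* lift Ã) I J n        ≡⟨ *-lift Ã E I J n ⟩
    (Θ (ℤ.+ n ℚ./ 1) Mat.* Ã) I J  ≡⟨ Mat.*-congʳ {Ã} {Θ (ℤ.+ n ℚ./ 1)} {Ã ^ n} (Θ≈Ã^ n) I J ⟩
    -- Powers unfold with the new factor on the left, so multiplication on the right has to be
    -- commuted first.
    (Ã ^ n Mat.* Ã) I J            ≡⟨ ^-comm n I J ⟩
    (Ã ^ suc n) I J                ≡⟨ Θ≈Ã^ (suc n) I J ⟨
    E I J (suc n)                  ∎)

  E-inverseʳ : (𝐈 - ƛ • lift Ã) SMat.* E ≈ 𝐈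
  E-inverseʳ = inverseʳ {ƛ} {lift Ã} {E} (unfold-E (lift Ã SMat.* E) λ I J n → begin
    (lift Ã SMat.* E) I J n        ≡⟨ lift-* Ã E I J n ⟩
    (Ã Mat.* Θ (ℤ.+ n ℚ./ 1)) I J  ≡⟨ Mat.*-congˡ {Ã} {Θ (ℤ.+ n ℚ./ 1)} {Ã ^ n} (Θ≈Ã^ n) I J ⟩
    (Ã ^ suc n) I J                ≡⟨ Θ≈Ã^ (suc n) I J ⟨
    E I J (suc n)                  ∎)

theorem2p14 : (L : LabeledPoset) → let open GeneratingFunction L in
    (Σ[ (inv , _) ∈ IsUnit (𝐈 - ƛ • lift Ã) ] E ≈ inv)
    × (Σ[ (1/[1-λ] , _) ∈ IsUnitₛ (1ₛ -ₛ ƛ) ]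
    Σ[ (inv , _) ∈ IsUnit (𝐈 - (ƛ *ₛ 1/[1-λ]) • lift A) ]
    E ≈ 1/[1-λ] • inv)
theorem2p14 L =
  ((E , E-inverseˡ , E-inverseʳ) , λ _ _ _ → ≡.refl) ,
  (1/[1-ƛ] , 1/[1-ƛ]-inverseˡ , 1/[1-ƛ]-inverseʳ) ,
  -- The factorisation of 1 - λÃ makes (1 - λ)E the second inverse; dividing by 1 - λ then recovers
  -- `E`.
  ((1ₛ -ₛ ƛ) • E
    , rescaled-inverseˡ {lift A} {lift Ã} {E} lift-Ã E-inverseˡ
    , rescaled-inverseʳ {lift A} {lift Ã} {E} lift-Ã E-inverseʳ) ,
  ·-cancel E
  where
  open GeneratingFunction L
  open PosetResolvent L
  open GeometricSeries ℚ.+-*-commutativeRing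
  open Resolvent.Rescaling (SeriesRing.seriesRing ℚ.+-*-commutativeRing)
    Mat[[x]].matrices Mat[[x]].isAssociativeAlgebra {ƛ} {1/[1-ƛ]} 1/[1-ƛ]-inverseˡ
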